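{- Let $d\ge2$ be an integer, let $i\in\{1,\dots,d\}$ and let $c\in\mathbb{Q}$. Then the hyperplane $\{\boldsymbol{x}\in\mathbb{R}^d: x_i=c\}$ (the perpendicular translate of a coordinate hyperplane by the rational number $c$) is of Khintchine type for divergence, but is not of Khintchine type for convergence.
   Context: An approximating function is a non-increasing function $\psi:\mathbb{N}\to[0,\infty)$. A point $\boldsymbol{x}\in\mathbb{R}^d$ is $\psi$-approximable if $\|q\boldsymbol{x}-\boldsymbol{p}\|_\infty<\psi(q)$ holds for infinitely many $(\boldsymbol{p},q)\in\mathbb{Z}^d\times\mathbb{N}$. A manifold $\mathcal{M}\subset\mathbb{R}^d$ is of Khintchine type for divergence if for every approximating function $\psi$ with $\sum_{q}\psi(q)^d=\infty$, almost every point of $\mathcal{M}$ is $\psi$-approximable; it is of Khintchine type for convergence if for every approximating function $\psi$ with $\sum_q\psi(q)^d<\infty$, almost no point of $\mathcal{M}$ is $\psi$-approximable. For a hyperplane, "almost every/no" refers to $(d-1)$-dimensional Lebesgue measure on it. -}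

module Defs where

open import Data.Fin.Base using (Fin; zero; suc; toℕ)
open import Data.Integer.Base using (ℤ; +_)
open import Data.List.Base using (List)
open import Data.List.Membership.Propositional using (_∉_)
open import Data.Nat.Base as ℕ using (ℕ; zero; suc; NonZero)
import Data.Nat.Properties as ℕ
open import Data.Product.Base using (∃-syntax; Σ-syntax; _×_; _,_)
open import Data.Rational.Base as ℚ using (ℚ; 0ℚ; 1ℚ; ½)
import Data.Rational.Properties as ℚ
open import Data.Rational.Solver using (module +-*-Solver)
open import Data.Sum.Base using (inj₁; inj₂)
open import Data.Vec.Base using (Vec; lookup)
open import Data.Vec.Functional using (Vector; foldr; insertAt)
open import Level using (0ℓ)
open import Relation.Binary.PropositionalEquality
open import Relation.Nullary.Negation using (¬_)
open import Relation.Unary using (Pred)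

------------------------------------------------------------------------
-- Real numbers: Cauchy sequences of rationals, up to _≈_

IsCauchy : (ℕ → ℚ) → Set
IsCauchy x = ∀ ε → 0ℚ ℚ.< ε →
  ∃[ N ] (∀ m n → N ℕ.≤ m → N ℕ.≤ n → ℚ.∣ x m ℚ.- x n ∣ ℚ.≤ ε)

record ℝ : Set where
  constructor mkℝ
  field
    seq    : ℕ → ℚ
    cauchy : IsCauchy seq

open ℝ public

infix 4 _≤_ _<_ _≈_

_<_ : ℝ → ℝ → Set
x < y = ∃[ ε ] 0ℚ ℚ.< ε × ∃[ N ] (∀ n → N ℕ.≤ n → seq x n ℚ.+ ε ℚ.≤ seq y n)

_≤_ : ℝ → ℝ → Set
x ≤ y = ∀ ε → 0ℚ ℚ.< ε → ∃[ N ] (∀ n → N ℕ.≤ n → seq x n ℚ.≤ seq y n ℚ.+ ε)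

_≈_ : ℝ → ℝ → Set
x ≈ y = x ≤ y × y ≤ x

module CauchyLemmas where
  half>0 : ∀ {ε} → 0ℚ ℚ.< ε → 0ℚ ℚ.< ½ ℚ.* ε
  half>0 {ε} ε>0 = subst (ℚ._< ½ ℚ.* ε) (ℚ.*-zeroʳ ½) (ℚ.*-monoʳ-<-pos ½ ε>0)

  halves : ∀ ε → ½ ℚ.* ε ℚ.+ ½ ℚ.* ε ≡ ε
  halves ε = trans (sym (ℚ.*-distribʳ-+ ε ½ ½)) (ℚ.*-identityˡ ε)

  p≤∣p∣ : ∀ p → p ℚ.≤ ℚ.∣ p ∣
  p≤∣p∣ p with ℚ.≤-total 0ℚ p
  ... | inj₁ 0≤p = ℚ.≤-reflexive (sym (ℚ.0≤p⇒∣p∣≡p 0≤p))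
  ... | inj₂ p≤0 = ℚ.≤-trans p≤0 (ℚ.0≤∣p∣ p)

  p≤q+∣p-q∣ : ∀ p q → p ℚ.≤ q ℚ.+ ℚ.∣ p ℚ.- q ∣
  p≤q+∣p-q∣ p q = subst (ℚ._≤ q ℚ.+ ℚ.∣ p ℚ.- q ∣) (lemma p q)
    (ℚ.+-monoʳ-≤ q (p≤∣p∣ (p ℚ.- q)))
    where
    open +-*-Solver
    lemma : ∀ p q → q ℚ.+ (p ℚ.- q) ≡ p
    lemma = solve 2 (λ p q → q :+ (p :- q) := p) refl

  ∣p-q∣≤ : ∀ {p q ε} → p ℚ.≤ q ℚ.+ ε → q ℚ.≤ p ℚ.+ ε → ℚ.∣ p ℚ.- q ∣ ℚ.≤ ε
  ∣p-q∣≤ {p} {q} {ε} p≤ q≤ with ℚ.∣p∣≡p∨∣p∣≡-p (p ℚ.- q)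
  ... | inj₁ eq = subst₂ ℚ._≤_ (sym eq) (lemma q ε) (ℚ.+-monoˡ-≤ (ℚ.- q) p≤)
    where
    open +-*-Solver
    lemma : ∀ q ε → (q ℚ.+ ε) ℚ.- q ≡ ε
    lemma = solve 2 (λ q ε → (q :+ ε) :- q := ε) refl
  ... | inj₂ eq = subst₂ ℚ._≤_ (trans (lemma₁ p q) (sym eq)) (lemma₂ p ε)
                    (ℚ.+-monoˡ-≤ (ℚ.- p) q≤)
    where
    open +-*-Solver
    lemma₁ : ∀ p q → q ℚ.- p ≡ ℚ.- (p ℚ.- q)
    lemma₁ = solve 2 (λ p q → q :- p := :- (p :- q)) refl
    lemma₂ : ∀ p ε → (p ℚ.+ ε) ℚ.- p ≡ ε
    lemma₂ = solve 2 (λ p ε → (p :+ ε) :- p := ε) refl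

  ∣p-q∣≤⇒p≤q+ε : ∀ {p q ε} → ℚ.∣ p ℚ.- q ∣ ℚ.≤ ε → p ℚ.≤ q ℚ.+ ε
  ∣p-q∣≤⇒p≤q+ε {p} {q} h = ℚ.≤-trans (p≤q+∣p-q∣ p q) (ℚ.+-monoʳ-≤ q h)

  ⊔-bound : ∀ {a b c d ε} → ℚ.∣ a ℚ.- c ∣ ℚ.≤ ε → ℚ.∣ b ℚ.- d ∣ ℚ.≤ ε →
            a ℚ.⊔ b ℚ.≤ (c ℚ.⊔ d) ℚ.+ ε
  ⊔-bound {a} {b} {c} {d} {ε} h k = ℚ.⊔-lub
    (ℚ.≤-trans (∣p-q∣≤⇒p≤q+ε {a} {c} h) (ℚ.+-monoˡ-≤ ε (ℚ.p≤p⊔q c d)))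
    (ℚ.≤-trans (∣p-q∣≤⇒p≤q+ε {b} {d} k) (ℚ.+-monoˡ-≤ ε (ℚ.p≤q⊔p c d)))

  eventuallyBounded : ∀ {x} → IsCauchy x →
    ∃[ B ] ℚ.Positive B × ∃[ N ] (∀ n → N ℕ.≤ n → ℚ.∣ x n ∣ ℚ.≤ B)
  eventuallyBounded {x} cx with cx 1ℚ (ℚ.positive⁻¹ 1ℚ)
  ... | N , h = ℚ.∣ x N ∣ ℚ.+ 1ℚ
              , ℚ.nonNeg+pos⇒pos ℚ.∣ x N ∣ {{ℚ.∣-∣-nonNeg (x N)}} 1ℚ
              , N , bound
    where
    open +-*-Solver
    lemma : ∀ p q → q ℚ.+ (p ℚ.- q) ≡ p
    lemma = solve 2 (λ p q → q :+ (p :- q) := p) refl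
    bound : ∀ n → N ℕ.≤ n → ℚ.∣ x n ∣ ℚ.≤ ℚ.∣ x N ∣ ℚ.+ 1ℚ
    bound n N≤n = ℚ.≤-trans
      (subst (λ z → ℚ.∣ z ∣ ℚ.≤ ℚ.∣ x N ∣ ℚ.+ ℚ.∣ x n ℚ.- x N ∣) (lemma (x n) (x N))
        (ℚ.∣p+q∣≤∣p∣+∣q∣ (x N) (x n ℚ.- x N)))
      (ℚ.+-monoʳ-≤ ℚ.∣ x N ∣ (h n N N≤n ℕ.≤-refl))

  bounded*small : ∀ {p q B ε} → (B>0 : ℚ.Positive B) →
    ℚ.∣ p ∣ ℚ.≤ B →
    ℚ.∣ q ∣ ℚ.≤ ε ℚ.* (ℚ.1/ B) {{ℚ.pos⇒nonZero B {{B>0}}}} →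
    ℚ.∣ p ℚ.* q ∣ ℚ.≤ ε
  bounded*small {p} {q} {B} {ε} B>0 p≤B q≤ = begin
    ℚ.∣ p ℚ.* q ∣              ≡⟨ ℚ.∣p*q∣≡∣p∣*∣q∣ p q ⟩
    ℚ.∣ p ∣ ℚ.* ℚ.∣ q ∣        ≤⟨ ℚ.*-monoʳ-≤-nonNeg ℚ.∣ q ∣ {{ℚ.∣-∣-nonNeg q}} p≤B ⟩
    B ℚ.* ℚ.∣ q ∣              ≤⟨ ℚ.*-monoˡ-≤-nonNeg B {{ℚ.pos⇒nonNeg B {{B>0}}}} q≤ ⟩
    B ℚ.* (ε ℚ.* B⁻¹)          ≡⟨ lemma B ε B⁻¹ ⟩
    ε ℚ.* (B ℚ.* B⁻¹)          ≡⟨ cong (ε ℚ.*_) (ℚ.*-inverseʳ B {{ℚ.pos⇒nonZero B {{B>0}}}}) ⟩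
    ε ℚ.* 1ℚ                   ≡⟨ ℚ.*-identityʳ ε ⟩
    ε                          ∎
    where
    open ℚ.≤-Reasoning
    open +-*-Solver using (solve; _:*_; _:=_)
    B⁻¹ : ℚ
    B⁻¹ = (ℚ.1/ B) {{ℚ.pos⇒nonZero B {{B>0}}}}
    lemma : ∀ a b c → a ℚ.* (b ℚ.* c) ≡ b ℚ.* (a ℚ.* c)
    lemma = solve 3 (λ a b c → a :* (b :* c) := b :* (a :* c)) refl

  quotient>0 : ∀ {ε B} → 0ℚ ℚ.< ε → (B>0 : ℚ.Positive B) →
    0ℚ ℚ.< ε ℚ.* (ℚ.1/ B) {{ℚ.pos⇒nonZero B {{B>0}}}}
  quotient>0 {ε} {B} ε>0 B>0 = ℚ.positive⁻¹ _
    {{ℚ.pos*pos⇒pos ε {{ℚ.positive ε>0}} _ {{ℚ.1/pos⇒pos B {{B>0}}}}}}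

  +-cauchy : ∀ {x y} → IsCauchy x → IsCauchy y → IsCauchy (λ n → x n ℚ.+ y n)
  +-cauchy {x} {y} cx cy ε ε>0 with cx _ (half>0 ε>0) | cy _ (half>0 ε>0)
  ... | M , h | N , k = M ℕ.⊔ N , λ m n m≥ n≥ → begin
    ℚ.∣ (x m ℚ.+ y m) ℚ.- (x n ℚ.+ y n) ∣
      ≡⟨ cong ℚ.∣_∣ (lemma (x m) (y m) (x n) (y n)) ⟩
    ℚ.∣ (x m ℚ.- x n) ℚ.+ (y m ℚ.- y n) ∣
      ≤⟨ ℚ.∣p+q∣≤∣p∣+∣q∣ (x m ℚ.- x n) (y m ℚ.- y n) ⟩
    ℚ.∣ x m ℚ.- x n ∣ ℚ.+ ℚ.∣ y m ℚ.- y n ∣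
      ≤⟨ ℚ.+-mono-≤ (h m n (ℕ.m⊔n≤o⇒m≤o M N m≥) (ℕ.m⊔n≤o⇒m≤o M N n≥))
                    (k m n (ℕ.m⊔n≤o⇒n≤o M N m≥) (ℕ.m⊔n≤o⇒n≤o M N n≥)) ⟩
    ½ ℚ.* ε ℚ.+ ½ ℚ.* ε
      ≡⟨ halves ε ⟩
    ε ∎
    where
    open ℚ.≤-Reasoning
    open +-*-Solver using (solve; _:+_; _:-_; _:=_)
    lemma : ∀ a b c d → (a ℚ.+ b) ℚ.- (c ℚ.+ d) ≡ (a ℚ.- c) ℚ.+ (b ℚ.- d)
    lemma = solve 4 (λ a b c d → (a :+ b) :- (c :+ d) := (a :- c) :+ (b :- d)) refl

  neg-cauchy : ∀ {x} → IsCauchy x → IsCauchy (λ n → ℚ.- x n)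
  neg-cauchy {x} cx ε ε>0 with cx ε ε>0
  ... | N , h = N , λ m n m≥ n≥ →
    subst (ℚ._≤ ε) (cong ℚ.∣_∣ (lemma (x m) (x n))) (h n m n≥ m≥)
    where
    open +-*-Solver
    lemma : ∀ a b → b ℚ.- a ≡ (ℚ.- a) ℚ.- (ℚ.- b)
    lemma = solve 2 (λ a b → b :- a := (:- a) :- (:- b)) refl

  product-bound : ∀ a b c d {A B ε} →
    (A>0 : ℚ.Positive A) (B>0 : ℚ.Positive B) →
    ℚ.∣ a ∣ ℚ.≤ A → ℚ.∣ d ∣ ℚ.≤ B →
    ℚ.∣ a ℚ.- c ∣ ℚ.≤ ε ℚ.* (ℚ.1/ B) {{ℚ.pos⇒nonZero B {{B>0}}}} →
    ℚ.∣ b ℚ.- d ∣ ℚ.≤ ε ℚ.* (ℚ.1/ A) {{ℚ.pos⇒nonZero A {{A>0}}}} →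
    ℚ.∣ a ℚ.* b ℚ.- c ℚ.* d ∣ ℚ.≤ ε ℚ.+ ε
  product-bound a b c d {A} {B} {ε} A>0 B>0 a≤A d≤B a-c≤ b-d≤ = begin
    ℚ.∣ a ℚ.* b ℚ.- c ℚ.* d ∣
      ≡⟨ cong ℚ.∣_∣ (lemma a b c d) ⟩
    ℚ.∣ a ℚ.* (b ℚ.- d) ℚ.+ d ℚ.* (a ℚ.- c) ∣
      ≤⟨ ℚ.∣p+q∣≤∣p∣+∣q∣ (a ℚ.* (b ℚ.- d)) (d ℚ.* (a ℚ.- c)) ⟩
    ℚ.∣ a ℚ.* (b ℚ.- d) ∣ ℚ.+ ℚ.∣ d ℚ.* (a ℚ.- c) ∣
      ≤⟨ ℚ.+-mono-≤ (bounded*small {a} {b ℚ.- d} {A} {ε} A>0 a≤A b-d≤)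
                    (bounded*small {d} {a ℚ.- c} {B} {ε} B>0 d≤B a-c≤) ⟩
    ε ℚ.+ ε ∎
    where
    open ℚ.≤-Reasoning
    open +-*-Solver using (solve; _:+_; _:*_; _:-_; _:=_)
    lemma : ∀ a b c d → a ℚ.* b ℚ.- c ℚ.* d ≡ a ℚ.* (b ℚ.- d) ℚ.+ d ℚ.* (a ℚ.- c)
    lemma = solve 4 (λ a b c d → a :* b :- c :* d := a :* (b :- d) :+ d :* (a :- c)) refl

  *-cauchy : ∀ {x y} → IsCauchy x → IsCauchy y → IsCauchy (λ n → x n ℚ.* y n)
  *-cauchy {x} {y} cx cy ε ε>0 =
    let A , A>0 , K , a = eventuallyBounded {x} cx
        B , B>0 , L , b = eventuallyBounded {y} cy
        M , h = cx _ (quotient>0 {½ ℚ.* ε} {B} (half>0 {ε} ε>0) B>0)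
        N , k = cy _ (quotient>0 {½ ℚ.* ε} {A} (half>0 {ε} ε>0) A>0)
    in (K ℕ.⊔ L) ℕ.⊔ (M ℕ.⊔ N) , λ m n m≥ n≥ →
      let m≥KL = ℕ.m⊔n≤o⇒m≤o (K ℕ.⊔ L) (M ℕ.⊔ N) m≥
          m≥MN = ℕ.m⊔n≤o⇒n≤o (K ℕ.⊔ L) (M ℕ.⊔ N) m≥
          n≥KL = ℕ.m⊔n≤o⇒m≤o (K ℕ.⊔ L) (M ℕ.⊔ N) n≥
          n≥MN = ℕ.m⊔n≤o⇒n≤o (K ℕ.⊔ L) (M ℕ.⊔ N) n≥
      in subst (ℚ.∣ x m ℚ.* y m ℚ.- x n ℚ.* y n ∣ ℚ.≤_) (halves ε)
           (product-bound (x m) (y m) (x n) (y n) {A} {B} {½ ℚ.* ε}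
             A>0 B>0
             (a m (ℕ.m⊔n≤o⇒m≤o K L m≥KL))
             (b n (ℕ.m⊔n≤o⇒n≤o K L n≥KL))
             (h m n (ℕ.m⊔n≤o⇒m≤o M N m≥MN) (ℕ.m⊔n≤o⇒m≤o M N n≥MN))
             (k m n (ℕ.m⊔n≤o⇒n≤o M N m≥MN) (ℕ.m⊔n≤o⇒n≤o M N n≥MN)))

  ⊔-cauchy : ∀ {x y} → IsCauchy x → IsCauchy y → IsCauchy (λ n → x n ℚ.⊔ y n)
  ⊔-cauchy {x} {y} cx cy ε ε>0 with cx ε ε>0 | cy ε ε>0
  ... | M , h | N , k = M ℕ.⊔ N , λ m n m≥ n≥ →
    let M≤m = ℕ.m⊔n≤o⇒m≤o M N m≥ ; M≤n = ℕ.m⊔n≤o⇒m≤o M N n≥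
        N≤m = ℕ.m⊔n≤o⇒n≤o M N m≥ ; N≤n = ℕ.m⊔n≤o⇒n≤o M N n≥
    in ∣p-q∣≤ {x m ℚ.⊔ y m} {x n ℚ.⊔ y n}
         (⊔-bound {x m} {y m} {x n} {y n} (h m n M≤m M≤n) (k m n N≤m N≤n))
         (⊔-bound {x n} {y n} {x m} {y m} (h n m M≤n M≤m) (k n m N≤n N≤m))

  const-cauchy : ∀ p → IsCauchy (λ _ → p)
  const-cauchy p ε ε>0 = 0 , λ _ _ _ _ →
    subst (ℚ._≤ ε) (cong ℚ.∣_∣ (sym (ℚ.+-inverseʳ p))) (ℚ.<⇒≤ ε>0)

open CauchyLemmas

fromℚ : ℚ → ℝ
fromℚ p = mkℝ (λ _ → p) (const-cauchy p)

fromℤ : ℤ → ℝ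
fromℤ z = fromℚ (z ℚ./ 1)

0ℝ 1ℝ : ℝ
0ℝ = fromℚ 0ℚ
1ℝ = fromℚ 1ℚ

infixl 6 _+_ _-_ _⊔_
infixl 7 _*_
infix  8 -_
infixr 8 _^_

_+_ _*_ _⊔_ : ℝ → ℝ → ℝ
x + y = mkℝ (λ n → seq x n ℚ.+ seq y n) (+-cauchy {seq x} {seq y} (cauchy x) (cauchy y))
x * y = mkℝ (λ n → seq x n ℚ.* seq y n) (*-cauchy {seq x} {seq y} (cauchy x) (cauchy y))
x ⊔ y = mkℝ (λ n → seq x n ℚ.⊔ seq y n) (⊔-cauchy {seq x} {seq y} (cauchy x) (cauchy y))

-_ : ℝ → ℝ
- x = mkℝ (λ n → ℚ.- seq x n) (neg-cauchy {seq x} (cauchy x))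

_-_ : ℝ → ℝ → ℝ
x - y = x + (- y)

∣_∣ : ℝ → ℝ
∣ x ∣ = x ⊔ (- x)

_^_ : ℝ → ℕ → ℝ
x ^ zero  = 1ℝ
x ^ suc n = x * x ^ n

ℝ^_ : ℕ → Set
ℝ^ d = Vector ℝ d

‖_‖∞ : ∀ {d} → ℝ^ d → ℝ
‖ x ‖∞ = foldr (λ xⱼ m → ∣ xⱼ ∣ ⊔ m) 0ℝ x

------------------------------------------------------------------------
-- Sets of Lebesgue measure zero in ℝⁿ: for every ε > 0 there is a
-- countable cover by boxes of total volume at most ε.  Requiring the
-- corners of the boxes to be rational does not change the notion.

record Box (n : ℕ) : Set where
  field
    lower upper : Vector ℚ n
    lower≤upper : ∀ j → lower j ℚ.≤ upper j

open Box public

volume : ∀ {n} → Box n → ℚ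
volume B = foldr ℚ._*_ 1ℚ (λ j → upper B j ℚ.- lower B j)

_∈Box_ : ∀ {n} → ℝ^ n → Box n → Set
x ∈Box B = ∀ j → fromℚ (lower B j) ≤ x j × x j ≤ fromℚ (upper B j)

totalVolume : ∀ {n} → (ℕ → Box n) → ℕ → ℚ
totalVolume B K = foldr ℚ._+_ 0ℚ {K} (λ k → volume (B (toℕ k)))

LebesgueNull : ∀ {n} → Pred (ℝ^ n) 0ℓ → Set
LebesgueNull {n} S = ∀ ε → 0ℚ ℚ.< ε →
  Σ[ B ∈ (ℕ → Box n) ]
    (∀ x → S x → ∃[ k ] x ∈Box B k) ×
    (∀ K → totalVolume B K ℚ.≤ ε)

------------------------------------------------------------------------
-- ψ-approximable points; here ℕ is {1, 2, 3, …}

record ApproximatingFunction : Set where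
  field
    ψ             : (q : ℕ) .{{_ : NonZero q}} → ℝ
    nonNegative   : ∀ q .{{_ : NonZero q}} → 0ℝ ≤ ψ q
    nonIncreasing : ∀ p q .{{_ : NonZero p}} .{{_ : NonZero q}} →
                    p ℕ.≤ q → ψ q ≤ ψ p

open ApproximatingFunction public

-- ∑_{q = 1}^{N} ψ(q)^d
powerSum : ApproximatingFunction → ℕ → ℕ → ℝ
powerSum f d zero    = 0ℝ
powerSum f d (suc N) = powerSum f d N + ψ f (suc N) ^ d

-- The series has non-negative terms, so it converges iff its partial
-- sums are bounded.
SeriesConverges SeriesDiverges : ApproximatingFunction → ℕ → Set
SeriesConverges f d = ∃[ M ] (∀ N → powerSum f d N ≤ M)
SeriesDiverges  f d = ∀ M → ∃[ N ] M < powerSum f d N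

InfinitelyMany : {A : Set} → Pred A 0ℓ → Set
InfinitelyMany {A} P = ∀ (as : List A) → ∃[ a ] P a × a ∉ as

-- Integer vectors are Vec rather than Fin d → ℤ: InfinitelyMany counts
-- up to _≡_, which is too fine for functions without extensionality.
Approximable : ∀ {d} → ApproximatingFunction → Pred (ℝ^ d) 0ℓ
Approximable {d} f x = InfinitelyMany {Vec ℤ d × ℕ} λ (p , q) →
  Σ[ q≢0 ∈ NonZero q ]
    ‖ (λ j → fromℤ (+ q) * x j - fromℤ (lookup p j)) ‖∞ < ψ f q {{q≢0}}

------------------------------------------------------------------------
-- Khintchine types

-- A subset of ℝᵈ together with the null sets of its volume measure; for a
-- submanifold the Khintchine types depend on nothing else.
record MeasuredSet (d : ℕ) : Set₁ where
  field
    points : Pred (ℝ^ d) 0ℓ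
    Null   : Pred (Pred (ℝ^ d) 0ℓ) 0ℓ

open MeasuredSet public

AlmostEvery AlmostNo : ∀ {d} → MeasuredSet d → Pred (ℝ^ d) 0ℓ → Set
AlmostEvery M P = Null M (λ x → points M x × ¬ P x)
AlmostNo    M P = Null M (λ x → points M x × P x)

KhintchineDivergence KhintchineConvergence : ∀ {d} → MeasuredSet d → Set
KhintchineDivergence  {d} M =
  ∀ f → SeriesDiverges f d → AlmostEvery M (Approximable f)
KhintchineConvergence {d} M =
  ∀ f → SeriesConverges f d → AlmostNo M (Approximable f)

-- { x : xᵢ = c } with (d-1)-dimensional Lebesgue measure, transported
-- from ℝᵈ⁻¹ along the isometry that inserts c as i-th coordinate.
hyperplane : ∀ {d} → Fin d → ℚ → MeasuredSet d
hyperplane {suc n} i c = record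
  { points = λ x → x i ≈ fromℚ c
  ; Null   = λ S → LebesgueNull {n} (λ y → S (insertAt y i (fromℚ c)))
  }

{-# OPTIONS --safe #-}
-- Write n = d - 1. Call ψ large if for every b ≥ 1 there is k with
-- 2/2ᵏ < ψ(b 2ᵏⁿ). If ψ is large then every point x of the hyperplane is
-- ψ-approximable: given b, Dirichlet's theorem for the n coordinates of b x
-- other than the i-th yields 1 ≤ q ≤ 2ᵏⁿ with ‖q b x - p‖∞ ≤ 2/2ᵏ, the i-th
-- coordinate being exact as soon as the denominator of c divides b; and
-- denominators q b beyond any bound arise because b may be taken large.
--
-- Divergence: if ψ is not large, ψ(b 2ᵏⁿ) ≤ 2/2ᵏ for some b and all k, so the
-- terms ψ(q)ⁿ⁺¹ with b 2ᵏⁿ < q ≤ b 2⁽ᵏ⁺¹⁾ⁿ sum to O(2⁻ᵏ) and ∑ ψ(q)ⁿ⁺¹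
-- converges. Hence no point at all is exceptional.
--
-- Convergence: ψ(q) ≍ q^(-1/(n+1/2)) is large while ∑ ψ(q)ⁿ⁺¹ converges, and
-- ℝⁿ is not a null set. For the latter, a point outside boxes of total volume
-- less than 1 is found one coordinate at a time, as in Fubini's theorem: a
-- bisection finds a value of the first coordinate for which the slices of
-- the boxes still have total volume less than 1.
module Submission where

open import Defs
open CauchyLemmas
open import Algebra.Bundles using (module CommutativeRing)
open import Axiom.ExcludedMiddle using (ExcludedMiddle)
open import Data.Fin.Base using (Fin; zero; suc; toℕ; fromℕ<; funToFin; finToFun; punchIn; punchOut)
import Data.Fin.Properties as Fin
open import Data.Integer.Base as ℤ using (ℤ; +_)
import Data.Integer.DivMod as ℤ
import Data.Integer.Properties as ℤ
open import Data.Integer.Solver using () renaming (module +-*-Solver to ℤ-Solver)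
open import Data.List.Base using (List; []; _∷_)
open import Data.List.Membership.Propositional using (_∈_)
open import Data.List.Relation.Unary.Any using (here; there)
open import Data.Nat.Base as ℕ using (ℕ; zero; suc; NonZero)
import Data.Nat.DivMod as ℕ
open import Data.Nat.Logarithm using (⌊log₂_⌋; ⌊log₂⌋-mono-≤; ⌊log₂[2^n]⌋≡n)
import Data.Nat.Properties as ℕ
open import Data.Nat.Solver using () renaming (module +-*-Solver to ℕ-Solver)
open import Data.Product.Base using (∃-syntax; _×_; _,_; proj₁; proj₂)
open import Data.Rational.Base as ℚ using (ℚ; 0ℚ; 1ℚ; ½)
import Data.Rational.Properties as ℚ
open import Data.Rational.Solver using (module +-*-Solver)
import Data.Rational.Unnormalised.Base as ℚᵘ
import Data.Rational.Unnormalised.Properties as ℚᵘ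
open import Data.Sum.Base using (_⊎_; inj₁; inj₂; [_,_]′)
open import Data.Vec.Base using (Vec; lookup; tabulate)
open import Data.Vec.Functional as Vector using (foldr; insertAt)
import Data.Vec.Functional.Properties as Vector
import Data.Vec.Properties as Vec
open import Function.Base using (_∘_)
open import Level using (0ℓ)
open import Relation.Binary.PropositionalEquality
open import Relation.Nullary.Decidable.Core using (decidable-stable; Dec; yes; no; from-yes; toSum)
open import Relation.Nullary.Negation using (¬_; contradiction)
open import Relation.Unary using (Pred)
open import Algebra.Properties.CommutativeSemiring.Exp
  (CommutativeRing.commutativeSemiring ℚ.+-*-commutativeRing)
  using (^-homo-*; ^-assocʳ; ^-distrib-*)
  renaming (_^_ to _^ℚ_)
open +-*-Solver using (solve; _:=_; _:+_; _:*_; _:-_; con)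

-- Arithmetic and order in the rationals

infix 8 _/1

-- Opaque, since otherwise the conversion checker unfolds the gcd in ℚ._/_.
opaque
  _/1 : ℤ → ℚ
  z /1 = z ℚ./ 1

  /1-def : ∀ z → z /1 ≡ z ℚ./ 1
  /1-def z = refl

ι : ℕ → ℚ
ι n = (+ n) /1

-- Turns a linear inequality into a ring identity for the solver.
≤-shift : ∀ {a b p q} → a ℚ.≤ b → p ℚ.+ b ≡ q ℚ.+ a → p ℚ.≤ q
≤-shift {a} {b} {p} {q} a≤b eq = subst₂ ℚ._≤_ (cancel p b) (cancel q b)
  (ℚ.+-monoˡ-≤ (ℚ.- b) (subst (ℚ._≤ q ℚ.+ b) (sym eq) (ℚ.+-monoʳ-≤ q a≤b)))
  where
  cancel : ∀ p b → (p ℚ.+ b) ℚ.- b ≡ p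
  cancel = solve 2 (λ p b → (p :+ b) :- b := p) refl

*-monoʳ-≤ : ∀ {r p q} → 0ℚ ℚ.≤ r → p ℚ.≤ q → p ℚ.* r ℚ.≤ q ℚ.* r
*-monoʳ-≤ {r} 0≤r = ℚ.*-monoʳ-≤-nonNeg r {{ℚ.nonNegative 0≤r}}

*-monoˡ-≤ : ∀ {r p q} → 0ℚ ℚ.≤ r → p ℚ.≤ q → r ℚ.* p ℚ.≤ r ℚ.* q
*-monoˡ-≤ {r} 0≤r = ℚ.*-monoˡ-≤-nonNeg r {{ℚ.nonNegative 0≤r}}

*-nonNeg : ∀ {p q} → 0ℚ ℚ.≤ p → 0ℚ ℚ.≤ q → 0ℚ ℚ.≤ p ℚ.* q
*-nonNeg {p} {q} 0≤p 0≤q = subst (ℚ._≤ p ℚ.* q) (ℚ.*-zeroʳ p) (*-monoˡ-≤ 0≤p 0≤q)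

*-pos : ∀ {p q} → 0ℚ ℚ.< p → 0ℚ ℚ.< q → 0ℚ ℚ.< p ℚ.* q
*-pos {p} {q} 0<p 0<q = ℚ.positive⁻¹ _ {{ℚ.pos*pos⇒pos p {{ℚ.positive 0<p}} q {{ℚ.positive 0<q}}}}

+-nonNeg : ∀ {p q} → 0ℚ ℚ.≤ p → 0ℚ ℚ.≤ q → 0ℚ ℚ.≤ p ℚ.+ q
+-nonNeg = ℚ.+-mono-≤

-- Integers as rationals

toℚᵘ-/1 : ∀ z → ℚ.toℚᵘ (z /1) ℚᵘ.≃ ℚᵘ.mkℚᵘ z 0
toℚᵘ-/1 z = ℚᵘ.≃-trans (ℚᵘ.≃-reflexive (cong ℚ.toℚᵘ (/1-def z))) (ℚ.toℚᵘ-fromℚᵘ (ℚᵘ.mkℚᵘ z 0))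

/1-+ : ∀ y z → (y ℤ.+ z) /1 ≡ y /1 ℚ.+ z /1
/1-+ y z = ℚ.toℚᵘ-injective (begin
  ℚ.toℚᵘ ((y ℤ.+ z) /1)                  ≈⟨ toℚᵘ-/1 (y ℤ.+ z) ⟩
  ℚᵘ.mkℚᵘ (y ℤ.+ z) 0                    ≈⟨ ℚᵘ.*≡* (cong (ℤ._* ℤ.1ℤ)
                                              (sym (cong₂ ℤ._+_ (ℤ.*-identityʳ y) (ℤ.*-identityʳ z)))) ⟩
  ℚᵘ.mkℚᵘ y 0 ℚᵘ.+ ℚᵘ.mkℚᵘ z 0           ≈⟨ ℚᵘ.+-cong (toℚᵘ-/1 y) (toℚᵘ-/1 z) ⟨
  ℚ.toℚᵘ (y /1) ℚᵘ.+ ℚ.toℚᵘ (z /1)       ≈⟨ ℚ.toℚᵘ-homo-+ (y /1) (z /1) ⟨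
  ℚ.toℚᵘ (y /1 ℚ.+ z /1)                 ∎)
  where open ℚᵘ.≃-Reasoning

/1-* : ∀ y z → (y ℤ.* z) /1 ≡ y /1 ℚ.* z /1
/1-* y z = ℚ.toℚᵘ-injective (begin
  ℚ.toℚᵘ ((y ℤ.* z) /1)                  ≈⟨ toℚᵘ-/1 (y ℤ.* z) ⟩
  ℚᵘ.mkℚᵘ y 0 ℚᵘ.* ℚᵘ.mkℚᵘ z 0           ≈⟨ ℚᵘ.*-cong (toℚᵘ-/1 y) (toℚᵘ-/1 z) ⟨
  ℚ.toℚᵘ (y /1) ℚᵘ.* ℚ.toℚᵘ (z /1)       ≈⟨ ℚ.toℚᵘ-homo-* (y /1) (z /1) ⟨
  ℚ.toℚᵘ (y /1 ℚ.* z /1)                 ∎)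
  where open ℚᵘ.≃-Reasoning

/1-mono-≤ : ∀ {y z} → y ℤ.≤ z → y /1 ℚ.≤ z /1
/1-mono-≤ {y} {z} y≤z = ℚ.toℚᵘ-cancel-≤ (begin
  ℚ.toℚᵘ (y /1) ≃⟨ toℚᵘ-/1 y ⟩
  ℚᵘ.mkℚᵘ y 0   ≤⟨ ℚᵘ.*≤* (ℤ.*-monoʳ-≤-nonNeg ℤ.1ℤ y≤z) ⟩
  ℚᵘ.mkℚᵘ z 0   ≃⟨ toℚᵘ-/1 z ⟨
  ℚ.toℚᵘ (z /1) ∎)
  where open ℚᵘ.≤-Reasoning

ι-+ : ∀ m n → ι (m ℕ.+ n) ≡ ι m ℚ.+ ι n
ι-+ m n = /1-+ (+ m) (+ n)

ι-* : ∀ m n → ι (m ℕ.* n) ≡ ι m ℚ.* ι n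
ι-* m n = trans (cong _/1 (ℤ.pos-* m n)) (/1-* (+ m) (+ n))

ι-0 : ι 0 ≡ 0ℚ
ι-0 = /1-def (+ 0)

ι-1 : ι 1 ≡ 1ℚ
ι-1 = /1-def (+ 1)

ι-suc : ∀ n → ι (suc n) ≡ 1ℚ ℚ.+ ι n
ι-suc n = trans (ι-+ 1 n) (cong (ℚ._+ ι n) ι-1)

ι-mono-≤ : ∀ {m n} → m ℕ.≤ n → ι m ℚ.≤ ι n
ι-mono-≤ m≤n = /1-mono-≤ (ℤ.+≤+ m≤n)

ι-nonNeg : ∀ n → 0ℚ ℚ.≤ ι n
ι-nonNeg n = subst (ℚ._≤ ι n) ι-0 (ι-mono-≤ {0} {n} ℕ.z≤n)

p*↧p≡↥p : ∀ p → p ℚ.* ι (ℚ.↧ₙ p) ≡ (ℚ.↥ p) /1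
p*↧p≡↥p p@record{} = ℚ.toℚᵘ-injective (begin
  ℚ.toℚᵘ (p ℚ.* ι (ℚ.↧ₙ p))            ≈⟨ ℚ.toℚᵘ-homo-* p (ι (ℚ.↧ₙ p)) ⟩
  ℚ.toℚᵘ p ℚᵘ.* ℚ.toℚᵘ (ι (ℚ.↧ₙ p))    ≈⟨ ℚᵘ.*-congˡ {ℚ.toℚᵘ p} (toℚᵘ-/1 (ℚ.↧ p)) ⟩
  ℚ.toℚᵘ p ℚᵘ.* ℚᵘ.mkℚᵘ (ℚ.↧ p) 0      ≈⟨ ℚᵘ.*≡* (ℤ.*-assoc (ℚ.↥ p) (ℚ.↧ p) ℤ.1ℤ) ⟩
  ℚᵘ.mkℚᵘ (ℚ.↥ p) 0                    ≈⟨ toℚᵘ-/1 (ℚ.↥ p) ⟨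
  ℚ.toℚᵘ ((ℚ.↥ p) /1)                  ∎)
  where open ℚᵘ.≃-Reasoning

1≤↥ : ∀ p → 0ℚ ℚ.< p → ℤ.1ℤ ℤ.≤ ℚ.↥ p
1≤↥ p@record{} 0<p = ℤ.i<j⇒suc[i]≤j (ℤ.positive⁻¹ (ℚ.↥ p) {{ℚ.positive 0<p}})

-- Euclidean division of the numerator by the denominator. The weak upper bound fits the closed
-- cells of `InCell`.
floor-bounds : ∀ p → ∃[ z ] z /1 ℚ.≤ p × p ℚ.≤ z /1 ℚ.+ 1ℚ
floor-bounds p@record{} = z
  , ℚ.*-cancelʳ-≤-pos (ι d) {{ι-pos}} (begin
      z /1 ℚ.* ι d            ≡⟨ /1-* z (+ d) ⟨
      (z ℤ.* + d) /1          ≤⟨ /1-mono-≤ (ℤ.[n/ℕd]*d≤n (ℚ.↥ p) d) ⟩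
      (ℚ.↥ p) /1              ≡⟨ p*↧p≡↥p p ⟨
      p ℚ.* ι d               ∎)
  , ℚ.*-cancelʳ-≤-pos (ι d) {{ι-pos}} (begin
      p ℚ.* ι d               ≡⟨ p*↧p≡↥p p ⟩
      (ℚ.↥ p) /1              ≤⟨ /1-mono-≤ (ℤ.<⇒≤ (ℤ.n<s[n/ℕd]*d (ℚ.↥ p) d)) ⟩
      (ℤ.suc z ℤ.* + d) /1    ≡⟨ /1-* (ℤ.suc z) (+ d) ⟩
      ℤ.suc z /1 ℚ.* ι d      ≡⟨ cong (ℚ._* ι d) (trans (/1-+ ℤ.1ℤ z) (trans (cong (ℚ._+ z /1) ι-1) (ℚ.+-comm 1ℚ (z /1)))) ⟩
      (z /1 ℚ.+ 1ℚ) ℚ.* ι d   ∎)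
  where
  open ℚ.≤-Reasoning
  d = ℚ.↧ₙ p
  z = ℚ.↥ p ℤ./ℕ d
  ι-pos : ℚ.Positive (ι d)
  ι-pos = ℚ.positive (ℚ.<-≤-trans (ℚ.positive⁻¹ 1ℚ) (subst (ℚ._≤ ι d) ι-1 (ι-mono-≤ {1} {d} (ℕ.>-nonZero⁻¹ d))))

-- Powers

^-nonNeg : ∀ {p} → 0ℚ ℚ.≤ p → ∀ n → 0ℚ ℚ.≤ p ^ℚ n
^-nonNeg 0≤p zero    = ℚ.nonNegative⁻¹ 1ℚ
^-nonNeg 0≤p (suc n) = *-nonNeg 0≤p (^-nonNeg 0≤p n)

-- Absolute values appear because a non-negative real may be represented by a sequence with negative
-- terms.
∣^∣-mono-≤ : ∀ {p q} → ℚ.∣ p ∣ ℚ.≤ q → ∀ n → ℚ.∣ p ^ℚ n ∣ ℚ.≤ q ^ℚ n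
∣^∣-mono-≤         h zero    = ℚ.≤-refl
∣^∣-mono-≤ {p} {q} h (suc n) = begin
  ℚ.∣ p ℚ.* p ^ℚ n ∣         ≡⟨ ℚ.∣p*q∣≡∣p∣*∣q∣ p (p ^ℚ n) ⟩
  ℚ.∣ p ∣ ℚ.* ℚ.∣ p ^ℚ n ∣   ≤⟨ *-monoʳ-≤ (ℚ.0≤∣p∣ (p ^ℚ n)) h ⟩
  q ℚ.* ℚ.∣ p ^ℚ n ∣         ≤⟨ *-monoˡ-≤ (ℚ.≤-trans (ℚ.0≤∣p∣ p) h) (∣^∣-mono-≤ h n) ⟩
  q ℚ.* q ^ℚ n               ∎
  where open ℚ.≤-Reasoning

½^>0 : ∀ n → 0ℚ ℚ.< ½ ^ℚ n
½^>0 zero    = ℚ.positive⁻¹ 1ℚ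
½^>0 (suc n) = half>0 (½^>0 n)

½^≥0 : ∀ n → 0ℚ ℚ.≤ ½ ^ℚ n
½^≥0 n = ℚ.<⇒≤ (½^>0 n)

½^-halves : ∀ n → ½ ^ℚ suc n ℚ.+ ½ ^ℚ suc n ≡ ½ ^ℚ n
½^-halves n = halves (½ ^ℚ n)

½^-suc-≤ : ∀ n → ½ ^ℚ suc n ℚ.≤ ½ ^ℚ n
½^-suc-≤ n = subst₂ ℚ._≤_ (ℚ.+-identityʳ _) (½^-halves n) (ℚ.+-monoʳ-≤ (½ ^ℚ suc n) (½^≥0 (suc n)))

½^-anti-≤ : ∀ {m n} → m ℕ.≤ n → ½ ^ℚ n ℚ.≤ ½ ^ℚ m
½^-anti-≤ m≤n = go (ℕ.≤⇒≤′ m≤n)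
  where
  go : ∀ {m n} → m ℕ.≤′ n → ½ ^ℚ n ℚ.≤ ½ ^ℚ m
  go ℕ.≤′-refl               = ℚ.≤-refl
  go (ℕ.≤′-step {n = n} m≤n) = ℚ.≤-trans (½^-suc-≤ n) (go m≤n)

ι2^*½^ : ∀ n → ι (2 ℕ.^ n) ℚ.* ½ ^ℚ n ≡ 1ℚ
ι2^*½^ zero    = trans (ℚ.*-identityʳ (ι 1)) ι-1
ι2^*½^ (suc n) = begin
  ι (2 ℕ.* 2 ℕ.^ n) ℚ.* (½ ℚ.* ½ ^ℚ n)          ≡⟨ cong (ℚ._* (½ ℚ.* ½ ^ℚ n)) (ι-* 2 (2 ℕ.^ n)) ⟩
  (ι 2 ℚ.* ι (2 ℕ.^ n)) ℚ.* (½ ℚ.* ½ ^ℚ n)      ≡⟨ lemma (ι 2) (ι (2 ℕ.^ n)) ½ (½ ^ℚ n) ⟩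
  (ι 2 ℚ.* ½) ℚ.* (ι (2 ℕ.^ n) ℚ.* ½ ^ℚ n)      ≡⟨ cong₂ ℚ._*_ (cong (ℚ._* ½) (/1-def (+ 2))) (ι2^*½^ n) ⟩
  1ℚ                                            ∎
  where
  open ≡-Reasoning
  lemma : ∀ a b c d → (a ℚ.* b) ℚ.* (c ℚ.* d) ≡ (a ℚ.* c) ℚ.* (b ℚ.* d)
  lemma = solve 4 (λ a b c d → (a :* b) :* (c :* d) := (a :* c) :* (b :* d)) refl

n<2^n : ∀ n → n ℕ.< 2 ℕ.^ n
n<2^n zero    = ℕ.s≤s ℕ.z≤n
n<2^n (suc n) = ℕ.+-mono-≤ (ℕ.m^n>0 2 n) (subst (n ℕ.<_) (sym (ℕ.+-identityʳ (2 ℕ.^ n))) (n<2^n n))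

ι*½^≤1 : ∀ n → ι n ℚ.* ½ ^ℚ n ℚ.≤ 1ℚ
ι*½^≤1 n = subst (ι n ℚ.* ½ ^ℚ n ℚ.≤_) (ι2^*½^ n)
  (*-monoʳ-≤ (½^≥0 n) (ι-mono-≤ {n} {2 ℕ.^ n} (ℕ.<⇒≤ (n<2^n n))))

-- Archimedean property with `N` the denominator of `ε`: the product of `ε` and `N` is the
-- numerator, hence at least 1, while `ι N ℚ.* ½ ^ℚ N` is at most 1.
½^-small : ∀ {ε} → 0ℚ ℚ.< ε → ∃[ N ] ½ ^ℚ N ℚ.≤ ε
½^-small {ε} 0<ε = N , (begin
  ½ ^ℚ N                           ≡⟨ trans (cong (ℚ._* ½ ^ℚ N) ι-1) (ℚ.*-identityˡ (½ ^ℚ N)) ⟨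
  ι 1 ℚ.* ½ ^ℚ N                   ≤⟨ *-monoʳ-≤ (½^≥0 N) (/1-mono-≤ {+ 1} {ℚ.↥ ε} (1≤↥ ε 0<ε)) ⟩
  (ℚ.↥ ε) /1 ℚ.* ½ ^ℚ N            ≡⟨ cong (ℚ._* ½ ^ℚ N) (p*↧p≡↥p ε) ⟨
  (ε ℚ.* ι N) ℚ.* ½ ^ℚ N           ≡⟨ ℚ.*-assoc ε (ι N) (½ ^ℚ N) ⟩
  ε ℚ.* (ι N ℚ.* ½ ^ℚ N)           ≤⟨ *-monoˡ-≤ (ℚ.<⇒≤ 0<ε) (ι*½^≤1 N) ⟩
  ε ℚ.* 1ℚ                         ≡⟨ ℚ.*-identityʳ ε ⟩
  ε                                ∎)
  where
  open ℚ.≤-Reasoning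
  N = ℚ.↧ₙ ε

-- Dirichlet's theorem

-- `w` acts as the integer part of `s`, and `c` as its fractional part rounded down to a multiple of
-- 2⁻ᵏ. Both ends are closed, so neighbouring cells share an endpoint.
InCell : ∀ k → Fin (2 ℕ.^ k) → ℤ → ℚ → Set
InCell k c w s = w /1 ℚ.+ ι (toℕ c) ℚ.* ½ ^ℚ k ℚ.≤ s
               × s ℚ.≤ (w /1 ℚ.+ ι (toℕ c) ℚ.* ½ ^ℚ k) ℚ.+ ½ ^ℚ k

-- With `u` the floor of 2ᵏ s, `w` and `c` are the quotient and the remainder of `u` modulo 2ᵏ.
cell : ∀ k s → ∃[ c ] ∃[ w ] InCell k c w s
cell k s = c , w
  , subst₂ ℚ._≤_ scale-u scale-s (*-monoʳ-≤ (½^≥0 k) (proj₁ bounds))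
  , subst₂ ℚ._≤_ scale-s (trans (lemma (u /1) h) (cong (ℚ._+ h) scale-u))
      (*-monoʳ-≤ (½^≥0 k) (proj₂ bounds))
  where
  open ≡-Reasoning
  N = 2 ℕ.^ k
  h = ½ ^ℚ k
  instance
    N≢0 : NonZero N
    N≢0 = ℕ.m^n≢0 2 k
  u = proj₁ (floor-bounds (s ℚ.* ι N))
  bounds = proj₂ (floor-bounds (s ℚ.* ι N))
  w = u ℤ./ℕ N
  c = fromℕ< (ℤ.n%ℕd<d u N)
  lemma : ∀ a h → (a ℚ.+ 1ℚ) ℚ.* h ≡ a ℚ.* h ℚ.+ h
  lemma = solve 2 (λ a h → (a :+ con 1ℚ) :* h := a :* h :+ h) refl
  scale-s : (s ℚ.* ι N) ℚ.* h ≡ s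
  scale-s = trans (ℚ.*-assoc s (ι N) h) (trans (cong (s ℚ.*_) (ι2^*½^ k)) (ℚ.*-identityʳ s))
  distrib : ∀ a b c d → (a ℚ.+ b ℚ.* c) ℚ.* d ≡ b ℚ.* (c ℚ.* d) ℚ.+ a ℚ.* d
  distrib = solve 4 (λ a b c d → (a :+ b :* c) :* d := b :* (c :* d) :+ a :* d) refl
  scale-u : u /1 ℚ.* h ≡ w /1 ℚ.+ ι (toℕ c) ℚ.* h
  scale-u = begin
    u /1 ℚ.* h                                        ≡⟨ cong (λ z → z /1 ℚ.* h) (ℤ.a≡a%ℕn+[a/ℕn]*n u N) ⟩
    (+ (u ℤ.%ℕ N) ℤ.+ w ℤ.* + N) /1 ℚ.* h             ≡⟨ cong (ℚ._* h) (trans (/1-+ (+ (u ℤ.%ℕ N)) (w ℤ.* + N))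
                                                         (cong (ι (u ℤ.%ℕ N) ℚ.+_) (/1-* w (+ N)))) ⟩
    (ι (u ℤ.%ℕ N) ℚ.+ w /1 ℚ.* ι N) ℚ.* h             ≡⟨ distrib (ι (u ℤ.%ℕ N)) (w /1) (ι N) h ⟩
    w /1 ℚ.* (ι N ℚ.* h) ℚ.+ ι (u ℤ.%ℕ N) ℚ.* h       ≡⟨ cong₂ ℚ._+_
                                                         (trans (cong (w /1 ℚ.*_) (ι2^*½^ k)) (ℚ.*-identityʳ (w /1)))
                                                         (cong (λ r → ι r ℚ.* h) (sym (Fin.toℕ-fromℕ< (ℤ.n%ℕd<d u N)))) ⟩
    w /1 ℚ.+ ι (toℕ c) ℚ.* h                          ∎

-- Subtracting the two memberships cancels the common offset of `c` and leaves the difference of the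
-- integer parts, up to one cell length.
sameCell : ∀ k {c w v s t} → InCell k c w s → InCell k c v t →
           ℚ.∣ (s ℚ.- t) ℚ.- (w ℤ.- v) /1 ∣ ℚ.≤ ½ ^ℚ k
sameCell k {c} {w} {v} {s} {t} (ws≤ , ≤ws) (vt≤ , ≤vt) = ∣p-q∣≤ {s ℚ.- t} {P}
  (≤-shift (ℚ.+-mono-≤ ≤ws vt≤) (trans
    (cong (λ W → (s ℚ.- t) ℚ.+ (((W ℚ.+ C) ℚ.+ h) ℚ.+ t)) w≡)
    (lemma₁ s t P V C h)))
  (≤-shift (ℚ.+-mono-≤ ≤vt ws≤) (trans
    (lemma₂ s t P V C h)
    (cong (λ W → ((s ℚ.- t) ℚ.+ h) ℚ.+ (t ℚ.+ (W ℚ.+ C))) (sym w≡))))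
  where
  P = (w ℤ.- v) /1
  V = v /1
  C = ι (toℕ c) ℚ.* ½ ^ℚ k
  h = ½ ^ℚ k
  cancel : ∀ w v → w ≡ (w ℤ.- v) ℤ.+ v
  cancel = ℤ-Solver.solve 2 (λ w v → w ℤ-Solver.:= (w ℤ-Solver.:- v) ℤ-Solver.:+ v) refl
  w≡ : w /1 ≡ P ℚ.+ V
  w≡ = trans (cong _/1 (cancel w v)) (/1-+ (w ℤ.- v) v)
  lemma₁ : ∀ s t P V C h → (s ℚ.- t) ℚ.+ ((((P ℚ.+ V) ℚ.+ C) ℚ.+ h) ℚ.+ t) ≡ (P ℚ.+ h) ℚ.+ (s ℚ.+ (V ℚ.+ C))
  lemma₁ = solve 6 (λ s t P V C h →
    (s :- t) :+ ((((P :+ V) :+ C) :+ h) :+ t) := (P :+ h) :+ (s :+ (V :+ C))) refl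
  lemma₂ : ∀ s t P V C h → P ℚ.+ (((V ℚ.+ C) ℚ.+ h) ℚ.+ s) ≡ ((s ℚ.- t) ℚ.+ h) ℚ.+ (t ℚ.+ ((P ℚ.+ V) ℚ.+ C))
  lemma₂ = solve 6 (λ s t P V C h →
    P :+ (((V :+ C) :+ h) :+ s) := ((s :- t) :+ h) :+ (t :+ ((P :+ V) :+ C))) refl

-- Pigeonhole: the 2ᵏⁿ + 1 multiples of `s` by 0, ..., 2ᵏⁿ fall into 2ᵏⁿ products of cells, so two
-- of them share a product; `q` is the difference of their multipliers.
dirichlet : ∀ {n} k (s : Fin n → ℚ) → ∃[ q ] NonZero q × q ℕ.≤ 2 ℕ.^ (k ℕ.* n) ×
            (∀ j → ∃[ p ] ℚ.∣ ι q ℚ.* s j ℚ.- p /1 ∣ ℚ.≤ ½ ^ℚ k)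
dirichlet {n} k s = q₂ ℕ.∸ q₁ , ℕ.>-nonZero (ℕ.m<n⇒0<n∸m q₁<q₂) , q≤ , approx
  where
  cellOf : ℕ → Fin n → Fin (2 ℕ.^ k)
  cellOf q j = proj₁ (cell k (ι q ℚ.* s j))
  code : Fin (suc ((2 ℕ.^ k) ℕ.^ n)) → Fin ((2 ℕ.^ k) ℕ.^ n)
  code q = funToFin (cellOf (toℕ q))
  collision = Fin.pigeonhole (ℕ.n<1+n ((2 ℕ.^ k) ℕ.^ n)) code
  i₁ = proj₁ collision
  i₂ = proj₁ (proj₂ collision)
  q₁ = toℕ i₁
  q₂ = toℕ i₂
  q₁<q₂ : q₁ ℕ.< q₂
  q₁<q₂ = proj₁ (proj₂ (proj₂ collision))
  q≤ : q₂ ℕ.∸ q₁ ℕ.≤ 2 ℕ.^ (k ℕ.* n)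
  q≤ = ℕ.≤-trans (ℕ.m∸n≤m q₂ q₁)
    (subst (q₂ ℕ.≤_) (ℕ.^-*-assoc 2 k n) (ℕ.s≤s⁻¹ (Fin.toℕ<n i₂)))
  same : ∀ j → cellOf q₁ j ≡ cellOf q₂ j
  same j = trans (sym (Fin.finToFun-funToFin (cellOf q₁) j))
    (trans (cong (λ z → finToFun z j) (proj₂ (proj₂ (proj₂ collision))))
      (Fin.finToFun-funToFin (cellOf q₂) j))
  lemma : ∀ a b s → (a ℚ.+ b) ℚ.* s ℚ.- b ℚ.* s ≡ a ℚ.* s
  lemma = solve 3 (λ a b s → (a :+ b) :* s :- b :* s := a :* s) refl
  difference : ∀ t → ι q₂ ℚ.* t ℚ.- ι q₁ ℚ.* t ≡ ι (q₂ ℕ.∸ q₁) ℚ.* t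
  difference t = trans
    (cong (λ z → z ℚ.* t ℚ.- ι q₁ ℚ.* t) (trans
      (cong ι (sym (ℕ.m∸n+n≡m (ℕ.<⇒≤ q₁<q₂)))) (ι-+ (q₂ ℕ.∸ q₁) q₁)))
    (lemma (ι (q₂ ℕ.∸ q₁)) (ι q₁) t)
  approx : ∀ j → ∃[ p ] ℚ.∣ ι (q₂ ℕ.∸ q₁) ℚ.* s j ℚ.- p /1 ∣ ℚ.≤ ½ ^ℚ k
  approx j =
    let c₁ , w₁ , in₁ = cell k (ι q₁ ℚ.* s j)
        c₂ , w₂ , in₂ = cell k (ι q₂ ℚ.* s j)
    in w₂ ℤ.- w₁ , subst (λ z → ℚ.∣ z ℚ.- (w₂ ℤ.- w₁) /1 ∣ ℚ.≤ ½ ^ℚ k) (difference (s j))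
         (sameCell k {cellOf q₂ j} {w₂} {w₁} in₂
           (subst (λ c → InCell k c w₁ (ι q₁ ℚ.* s j)) (same j) in₁))

-- The order on ℝ

Eventually : (ℕ → Set) → Set
Eventually P = ∃[ N ] (∀ n → N ℕ.≤ n → P n)

eventually-zip : ∀ {P Q R : ℕ → Set} → (∀ n → P n → Q n → R n) →
                 Eventually P → Eventually Q → Eventually R
eventually-zip f (M , p) (N , q) = M ℕ.⊔ N , λ n MN≤n →
  f n (p n (ℕ.m⊔n≤o⇒m≤o M N MN≤n)) (q n (ℕ.m⊔n≤o⇒n≤o M N MN≤n))

eventually-map : ∀ {P Q : ℕ → Set} → (∀ n → P n → Q n) → Eventually P → Eventually Q
eventually-map f (N , p) = N , λ n N≤n → f n (p n N≤n)

eventually⇒≤ : ∀ {x y} → Eventually (λ n → seq x n ℚ.≤ seq y n) → x ≤ y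
eventually⇒≤ {x} {y} x≤y ε 0<ε = eventually-map (λ n xₙ≤yₙ → ℚ.≤-trans xₙ≤yₙ
  (subst (ℚ._≤ seq y n ℚ.+ ε) (ℚ.+-identityʳ (seq y n)) (ℚ.+-monoʳ-≤ (seq y n) (ℚ.<⇒≤ 0<ε)))) x≤y

fromℚ-mono-≤ : ∀ {p q} → p ℚ.≤ q → fromℚ p ≤ fromℚ q
fromℚ-mono-≤ {p} {q} p≤q = eventually⇒≤ {fromℚ p} {fromℚ q} (0 , λ _ _ → p≤q)

≤-trans : ∀ {x y z} → x ≤ y → y ≤ z → x ≤ z
≤-trans {x} {y} {z} x≤y y≤z ε 0<ε = eventually-zip
  (λ n p q → ℚ.≤-trans p (subst (seq y n ℚ.+ ½ ℚ.* ε ℚ.≤_)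
    (trans (ℚ.+-assoc (seq z n) (½ ℚ.* ε) (½ ℚ.* ε)) (cong (seq z n ℚ.+_) (halves ε)))
    (ℚ.+-monoˡ-≤ (½ ℚ.* ε) q)))
  (x≤y (½ ℚ.* ε) (half>0 0<ε)) (y≤z (½ ℚ.* ε) (half>0 0<ε))

<-≤-trans : ∀ {x y z} → x < y → y ≤ z → x < z
<-≤-trans {x} {y} {z} (ε , 0<ε , x<y) y≤z = ½ ℚ.* ε , half>0 0<ε , eventually-zip
  (λ n p q → ≤-shift {p = seq x n ℚ.+ ½ ℚ.* ε} {q = seq z n} (ℚ.+-mono-≤ p q)
    (trans (lemma (seq x n) (½ ℚ.* ε) (seq y n) (seq z n))
      (cong (λ e → seq z n ℚ.+ ((seq x n ℚ.+ e) ℚ.+ seq y n)) (halves ε))))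
  x<y (y≤z (½ ℚ.* ε) (half>0 0<ε))
  where
  lemma : ∀ x h y z → (x ℚ.+ h) ℚ.+ (y ℚ.+ (z ℚ.+ h)) ≡ z ℚ.+ ((x ℚ.+ (h ℚ.+ h)) ℚ.+ y)
  lemma = solve 4 (λ x h y z → (x :+ h) :+ (y :+ (z :+ h)) := z :+ ((x :+ (h :+ h)) :+ y)) refl

≤-<-trans : ∀ {x y z} → x ≤ y → y < z → x < z
≤-<-trans {x} {y} {z} x≤y (ε , 0<ε , y<z) = ½ ℚ.* ε , half>0 0<ε , eventually-zip
  (λ n p q → ≤-shift {p = seq x n ℚ.+ ½ ℚ.* ε} {q = seq z n} (ℚ.+-mono-≤ p q)
    (trans (lemma (seq x n) (½ ℚ.* ε) (seq y n) (seq z n))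
    (cong (λ e → (seq z n) ℚ.+ (seq x n ℚ.+ (seq y n ℚ.+ e))) (halves ε))))
  (x≤y (½ ℚ.* ε) (half>0 0<ε)) y<z
  where
  lemma : ∀ x h y z → (x ℚ.+ h) ℚ.+ ((y ℚ.+ h) ℚ.+ z) ≡ z ℚ.+ (x ℚ.+ (y ℚ.+ (h ℚ.+ h)))
  lemma = solve 4 (λ x h y z → (x :+ h) :+ ((y :+ h) :+ z) := z :+ (x :+ (y :+ (h :+ h)))) refl

<-irrefl : ∀ {x} → ¬ (x < x)
<-irrefl {x} (ε , 0<ε , N , x<x) = ℚ.<-irrefl refl (ℚ.<-≤-trans
  (subst (ℚ._< seq x N ℚ.+ ε) (ℚ.+-identityʳ (seq x N)) (ℚ.+-monoʳ-< (seq x N) 0<ε))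
  (x<x N ℕ.≤-refl))

-- Compare the rationals `seq x N` and r + ε/2 at an index beyond which `x` varies by at most δ =
-- ε/4. If the former is at most the latter, later terms stay below r + 3ε/4; otherwise they stay
-- above r + ε/4, which would give `fromℚ r < x`.
≮⇒≥ : ∀ {x r} → ¬ (fromℚ r < x) → x ≤ fromℚ r
≮⇒≥ {x} {r} r≮x ε 0<ε with cauchy x δ (half>0 (half>0 0<ε))
  where δ = ½ ℚ.* (½ ℚ.* ε)
... | N , near with seq x N ℚ.≤? r ℚ.+ ½ ℚ.* ε
...   | yes xN≤ = N , λ n N≤n → ≤-shift
          (ℚ.+-mono-≤ (ℚ.+-mono-≤ (∣p-q∣≤⇒p≤q+ε {seq x n} {seq x N} (near n N N≤n ℕ.≤-refl)) xN≤)
            (ℚ.<⇒≤ (half>0 (half>0 0<ε))))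
          (lemma (seq x n) (seq x N) r ε)
  where
  lemma : ∀ a b r e → a ℚ.+ (((b ℚ.+ ½ ℚ.* (½ ℚ.* e)) ℚ.+ (r ℚ.+ ½ ℚ.* e)) ℚ.+ ½ ℚ.* (½ ℚ.* e))
        ≡ (r ℚ.+ e) ℚ.+ ((a ℚ.+ b) ℚ.+ 0ℚ)
  lemma = solve 4 (λ a b r e → a :+ (((b :+ con ½ :* (con ½ :* e)) :+ (r :+ con ½ :* e)) :+ con ½ :* (con ½ :* e))
        := (r :+ e) :+ ((a :+ b) :+ con 0ℚ)) refl
...   | no xN≰ = contradiction (δ , half>0 (half>0 0<ε) , N , λ n N≤n → ≤-shift
          (ℚ.+-mono-≤ (∣p-q∣≤⇒p≤q+ε {seq x N} {seq x n} (near N n ℕ.≤-refl N≤n)) (ℚ.<⇒≤ (ℚ.≰⇒> xN≰)))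
          (lemma (seq x n) (seq x N) r ε)) r≮x
  where
  δ = ½ ℚ.* (½ ℚ.* ε)
  lemma : ∀ a b r e → (r ℚ.+ ½ ℚ.* (½ ℚ.* e)) ℚ.+ ((a ℚ.+ ½ ℚ.* (½ ℚ.* e)) ℚ.+ b)
        ≡ a ℚ.+ (b ℚ.+ (r ℚ.+ ½ ℚ.* e))
  lemma = solve 4 (λ a b r e → (r :+ con ½ :* (con ½ :* e)) :+ ((a :+ con ½ :* (con ½ :* e)) :+ b)
        := a :+ (b :+ (r :+ con ½ :* e))) refl

⊔-lub : ∀ {x y z} → x ≤ z → y ≤ z → x ⊔ y ≤ z
⊔-lub {x} {y} {z} x≤z y≤z ε 0<ε = eventually-zip (λ n p q → ℚ.⊔-lub p q) (x≤z ε 0<ε) (y≤z ε 0<ε)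

‖‖∞-lub : ∀ {d} (v : ℝ^ d) {z} → 0ℝ ≤ z → (∀ j → ∣ v j ∣ ≤ z) → ‖ v ‖∞ ≤ z
‖‖∞-lub {zero}  v     0≤z v≤z = 0≤z
‖‖∞-lub {suc d} v {z} 0≤z v≤z = ⊔-lub {∣ v zero ∣} {‖ (λ j → v (suc j)) ‖∞} {z}
  (v≤z zero) (‖‖∞-lub (λ j → v (suc j)) {z} 0≤z (λ j → v≤z (suc j)))

-p≤∣p∣ : ∀ p → ℚ.- p ℚ.≤ ℚ.∣ p ∣
-p≤∣p∣ p = subst (ℚ.- p ℚ.≤_) (ℚ.∣-p∣≡∣p∣ p) (p≤∣p∣ (ℚ.- p))

∣∣≤ : ∀ {x r} → Eventually (λ n → ℚ.∣ seq x n ∣ ℚ.≤ r) → ∣ x ∣ ≤ fromℚ r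
∣∣≤ {x} {r} h = eventually⇒≤ {∣ x ∣} {fromℚ r} (eventually-map (λ n xₙ≤r → ℚ.⊔-lub
  (ℚ.≤-trans (p≤∣p∣ (seq x n)) xₙ≤r) (ℚ.≤-trans (-p≤∣p∣ (seq x n)) xₙ≤r)) h)

-- Approximable points of a rational perpendicular hyperplane

Near : ℚ → ℝ → ℚ → Set
Near ε x r = Eventually (λ n → ℚ.∣ seq x n ℚ.- r ∣ ℚ.≤ ε)

≈⇒near : ∀ {x r ε} → 0ℚ ℚ.< ε → x ≈ fromℚ r → Near ε x r
≈⇒near {x} {r} {ε} 0<ε (x≤r , r≤x) =
  eventually-zip (λ n p q → ∣p-q∣≤ {seq x n} {r} p q) (x≤r ε 0<ε) (r≤x ε 0<ε)

∃-near : ∀ x {ε} → 0ℚ ℚ.< ε → ∃[ r ] Near ε x r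
∃-near x {ε} 0<ε with cauchy x ε 0<ε
... | N , near = seq x N , N , λ n N≤n → near n N N≤n ℕ.≤-refl

-- Split q x - p = q (x - r) + (q r - p); each summand is eventually at most `h` in absolute value.
near⇒∣∣≤ : ∀ {q ε h r x p} → Near ε x r → ι q ℚ.* ε ℚ.≤ h →
           ℚ.∣ ι q ℚ.* r ℚ.- p /1 ∣ ℚ.≤ h →
           ∣ fromℤ (+ q) * x - fromℤ p ∣ ≤ fromℚ (h ℚ.+ h)
near⇒∣∣≤ {q} {ε} {h} {r} {x} {p} near qε≤h qr≈p =
  ∣∣≤ {fromℤ (+ q) * x - fromℤ p} (eventually-map (λ n → bound (seq x n)) near)
  where
  open ℚ.≤-Reasoning
  split : ∀ q t r p → q ℚ.* t ℚ.- p ≡ q ℚ.* (t ℚ.- r) ℚ.+ (q ℚ.* r ℚ.- p)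
  split = solve 4 (λ q t r p → q :* t :- p := q :* (t :- r) :+ (q :* r :- p)) refl
  bound : ∀ t → ℚ.∣ t ℚ.- r ∣ ℚ.≤ ε → ℚ.∣ (+ q) ℚ./ 1 ℚ.* t ℚ.- p ℚ./ 1 ∣ ℚ.≤ h ℚ.+ h
  bound t t≈r = begin
    ℚ.∣ (+ q) ℚ./ 1 ℚ.* t ℚ.- p ℚ./ 1 ∣                      ≡⟨ cong₂ (λ y z → ℚ.∣ y ℚ.* t ℚ.- z ∣) (/1-def (+ q)) (/1-def p) ⟨
    ℚ.∣ ι q ℚ.* t ℚ.- p /1 ∣                                 ≡⟨ cong ℚ.∣_∣ (split (ι q) t r (p /1)) ⟩
    ℚ.∣ ι q ℚ.* (t ℚ.- r) ℚ.+ (ι q ℚ.* r ℚ.- p /1) ∣         ≤⟨ ℚ.∣p+q∣≤∣p∣+∣q∣ (ι q ℚ.* (t ℚ.- r)) (ι q ℚ.* r ℚ.- p /1) ⟩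
    ℚ.∣ ι q ℚ.* (t ℚ.- r) ∣ ℚ.+ ℚ.∣ ι q ℚ.* r ℚ.- p /1 ∣     ≤⟨ ℚ.+-monoʳ-≤ ℚ.∣ ι q ℚ.* (t ℚ.- r) ∣ qr≈p ⟩
    ℚ.∣ ι q ℚ.* (t ℚ.- r) ∣ ℚ.+ h                            ≡⟨ cong (ℚ._+ h) (trans (ℚ.∣p*q∣≡∣p∣*∣q∣ (ι q) (t ℚ.- r))
                                                                (cong (ℚ._* ℚ.∣ t ℚ.- r ∣) (ℚ.0≤p⇒∣p∣≡p (ι-nonNeg q)))) ⟩
    ι q ℚ.* ℚ.∣ t ℚ.- r ∣ ℚ.+ h                              ≤⟨ ℚ.+-monoˡ-≤ h (*-monoˡ-≤ (ι-nonNeg q) t≈r) ⟩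
    ι q ℚ.* ε ℚ.+ h                                          ≤⟨ ℚ.+-monoˡ-≤ h qε≤h ⟩
    h ℚ.+ h                                                  ∎

-- The rational version is applied to the multiples b r, where `r j` is a rational near `y j`.
dirichlet-near : ∀ {n} k b (y : ℝ^ n) → ∃[ q ] NonZero q × q ℕ.≤ 2 ℕ.^ (k ℕ.* n) ×
  (∀ j → ∃[ p ] ∣ fromℤ (+ (b ℕ.* q)) * y j - fromℤ p ∣ ≤ fromℚ (½ ^ℚ k ℚ.+ ½ ^ℚ k))
dirichlet-near {n} k b y = q , q≢0 , q≤D , λ j → proj₁ (close j) ,
  near⇒∣∣≤ {b ℕ.* q} {ε} {h} {r j} {y j} {proj₁ (close j)} (proj₂ (∃-near (y j) 0<ε)) bqε≤h
    (subst (λ z → ℚ.∣ z ℚ.- proj₁ (close j) /1 ∣ ℚ.≤ h) (bqr (r j)) (proj₂ (close j)))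
  where
  h = ½ ^ℚ k
  D = 2 ℕ.^ (k ℕ.* n)
  -- The precision is fixed before `q` is known, so it has to serve every q ≤ D; since b D ½^(b D) ≤
  -- 1, it gives b q ε ≤ h.
  ε = ½ ^ℚ (b ℕ.* D) ℚ.* h
  0<ε : 0ℚ ℚ.< ε
  0<ε = *-pos (½^>0 (b ℕ.* D)) (½^>0 k)
  r : Fin n → ℚ
  r j = proj₁ (∃-near (y j) 0<ε)
  approximation = dirichlet k (λ j → ι b ℚ.* r j)
  q = proj₁ approximation
  q≢0 : NonZero q
  q≢0 = proj₁ (proj₂ approximation)
  q≤D : q ℕ.≤ D
  q≤D = proj₁ (proj₂ (proj₂ approximation))
  close = proj₂ (proj₂ (proj₂ approximation))
  bqε≤h : ι (b ℕ.* q) ℚ.* ε ℚ.≤ h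
  bqε≤h = begin
    ι (b ℕ.* q) ℚ.* (½ ^ℚ (b ℕ.* D) ℚ.* h)   ≤⟨ *-monoʳ-≤ (ℚ.<⇒≤ 0<ε) (ι-mono-≤ {b ℕ.* q} {b ℕ.* D} (ℕ.*-monoʳ-≤ b q≤D)) ⟩
    ι (b ℕ.* D) ℚ.* (½ ^ℚ (b ℕ.* D) ℚ.* h)   ≡⟨ ℚ.*-assoc (ι (b ℕ.* D)) (½ ^ℚ (b ℕ.* D)) h ⟨
    (ι (b ℕ.* D) ℚ.* ½ ^ℚ (b ℕ.* D)) ℚ.* h   ≤⟨ *-monoʳ-≤ (½^≥0 k) (ι*½^≤1 (b ℕ.* D)) ⟩
    1ℚ ℚ.* h                                 ≡⟨ ℚ.*-identityˡ h ⟩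
    h                                        ∎
    where open ℚ.≤-Reasoning
  rotate : ∀ a b c → b ℚ.* (a ℚ.* c) ≡ (a ℚ.* b) ℚ.* c
  rotate = solve 3 (λ a b c → b :* (a :* c) := (a :* b) :* c) refl
  bqr : ∀ r → ι q ℚ.* (ι b ℚ.* r) ≡ ι (b ℕ.* q) ℚ.* r
  bqr r = trans (rotate (ι b) (ι q) r) (cong (ℚ._* r) (sym (ι-* b q)))

-- The denominator of `c` clears the fraction, so b c is exactly the integer `p`; the only error
-- comes from the sequence representing `x`.
rational-near : ∀ {c h x} m → x ≈ fromℚ c → 0ℚ ℚ.< h →
  ∃[ p ] ∣ fromℤ (+ (ℚ.↧ₙ c ℕ.* m)) * x - fromℤ p ∣ ≤ fromℚ (h ℚ.+ h)
rational-near {c} {h} {x} m x≈c 0<h = p ,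
  near⇒∣∣≤ {b} {ε} {h} {c} {x} {p} (≈⇒near {x} 0<ε x≈c) bε≤h
    (subst (λ z → ℚ.∣ z ∣ ℚ.≤ h) (sym exact) (ℚ.<⇒≤ 0<h))
  where
  b = ℚ.↧ₙ c ℕ.* m
  p = ℚ.↥ c ℤ.* + m
  ε = ½ ^ℚ b ℚ.* h
  0<ε : 0ℚ ℚ.< ε
  0<ε = *-pos (½^>0 b) 0<h
  bε≤h : ι b ℚ.* ε ℚ.≤ h
  bε≤h = subst₂ ℚ._≤_ (ℚ.*-assoc (ι b) (½ ^ℚ b) h) (ℚ.*-identityˡ h)
    (*-monoʳ-≤ (ℚ.<⇒≤ 0<h) (ι*½^≤1 b))
  open ≡-Reasoning
  rotate : ∀ a b c → (a ℚ.* b) ℚ.* c ≡ (c ℚ.* a) ℚ.* b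
  rotate = solve 3 (λ a b c → (a :* b) :* c := (c :* a) :* b) refl
  bc : ι b ℚ.* c ≡ p /1
  bc = begin
    ι b ℚ.* c                          ≡⟨ cong (ℚ._* c) (ι-* (ℚ.↧ₙ c) m) ⟩
    (ι (ℚ.↧ₙ c) ℚ.* ι m) ℚ.* c         ≡⟨ rotate (ι (ℚ.↧ₙ c)) (ι m) c ⟩
    (c ℚ.* ι (ℚ.↧ₙ c)) ℚ.* ι m         ≡⟨ cong (ℚ._* ι m) (p*↧p≡↥p c) ⟩
    (ℚ.↥ c) /1 ℚ.* ι m                 ≡⟨ /1-* (ℚ.↥ c) (+ m) ⟨
    p /1                               ∎
  exact : ι b ℚ.* c ℚ.- p /1 ≡ 0ℚ
  exact = trans (cong (ℚ._- p /1) bc) (ℚ.+-inverseʳ (p /1))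

-- Since ↧ₙ c divides b, the i-th coordinate does not constrain q.
dirichlet-hyperplane : ∀ {n} (i : Fin (suc n)) {c} k m (x : ℝ^ suc n) → x i ≈ fromℚ c →
  ∃[ q ] NonZero q × q ℕ.≤ 2 ℕ.^ (k ℕ.* n) × (∀ l → ∃[ p ]
    ∣ fromℤ (+ (ℚ.↧ₙ c ℕ.* m ℕ.* q)) * x l - fromℤ p ∣ ≤ fromℚ (½ ^ℚ k ℚ.+ ½ ^ℚ k))
dirichlet-hyperplane {n} i {c} k m x xᵢ≈c =
  q , proj₁ (proj₂ approximation) , proj₁ (proj₂ (proj₂ approximation)) ,
  λ l → coordinate l (i Fin.≟ l)
  where
  b = ℚ.↧ₙ c ℕ.* m
  approximation = dirichlet-near k b (λ j → x (punchIn i j))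
  q = proj₁ approximation
  close = proj₂ (proj₂ (proj₂ approximation))
  Close : Fin (suc n) → Set
  Close l = ∃[ p ] ∣ fromℤ (+ (b ℕ.* q)) * x l - fromℤ p ∣ ≤ fromℚ (½ ^ℚ k ℚ.+ ½ ^ℚ k)
  coordinate : ∀ l → Dec (i ≡ l) → Close l
  coordinate l (yes i≡l) = subst Close i≡l
    (subst (λ Q → ∃[ p ] ∣ fromℤ (+ Q) * x i - fromℤ p ∣ ≤ fromℚ (½ ^ℚ k ℚ.+ ½ ^ℚ k))
      (sym (ℕ.*-assoc (ℚ.↧ₙ c) m q))
      (rational-near {c} {½ ^ℚ k} {x i} (m ℕ.* q) xᵢ≈c (½^>0 k)))
  coordinate l (no i≢l)  = subst Close (Fin.punchIn-punchOut i≢l) (close (punchOut i≢l))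

-- A pair whose second entry exceeds the bound is new to the list; this is how infinitude is
-- obtained.
∃-bound : ∀ {A : Set} (as : List (A × ℕ)) → ∃[ B ] (∀ {a} → a ∈ as → proj₂ a ℕ.≤ B)
∃-bound []       = 0 , λ ()
∃-bound (a ∷ as) with ∃-bound as
... | B , bound = proj₂ a ℕ.⊔ B , λ
  { (here refl)  → ℕ.m≤m⊔n (proj₂ a) B
  ; (there a∈as) → ℕ.≤-trans (bound a∈as) (ℕ.m≤n⊔m (proj₂ a) B)
  }

-- The denominators at which ψ is sampled. The step `m` is n for Dirichlet's theorem and for
-- divergence, and 2n + 1 for the convergence of the series of `decay n`.
scale : ℕ → ℕ → ℕ → ℕ
scale b m k = b ℕ.* 2 ℕ.^ (k ℕ.* m)

scale≢0 : ∀ b .{{_ : NonZero b}} m k → NonZero (scale b m k)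
scale≢0 b {{b≢0}} m k = ℕ.m*n≢0 b (2 ℕ.^ (k ℕ.* m)) {{b≢0}} {{ℕ.m^n≢0 2 (k ℕ.* m)}}

ψ-scale : ApproximatingFunction → (b : ℕ) .{{_ : NonZero b}} → ℕ → ℕ → ℝ
ψ-scale f b m k = ψ f (scale b m k) {{scale≢0 b m k}}

-- Dirichlet's theorem gives ‖error‖ ≤ 2h < ψ(b 2ᵏⁿ) ≤ ψ(Q), the last step because Q = b q ≤ b 2ᵏⁿ.
approximable : ∀ {n} (i : Fin (suc n)) {c} f →
  (∀ b .{{_ : NonZero b}} → ∃[ k ] fromℚ (½ ^ℚ k ℚ.+ ½ ^ℚ k) < ψ-scale f b n k) →
  ∀ x → x i ≈ fromℚ c → Approximable f x
approximable {n} i {c} f large x xᵢ≈c as =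
  (p , Q) , (Q≢0 , ≤-<-trans {‖ error ‖∞} {fromℚ (h ℚ.+ h)} {ψ f Q {{Q≢0}}}
    (‖‖∞-lub error {fromℚ (h ℚ.+ h)} (fromℚ-mono-≤ {0ℚ} {h ℚ.+ h} (+-nonNeg (½^≥0 k) (½^≥0 k))) error≤)
    (<-≤-trans {fromℚ (h ℚ.+ h)} {ψ-scale f b n k} {ψ f Q {{Q≢0}}} (proj₂ (large b))
      (nonIncreasing f Q (scale b n k) {{Q≢0}} {{scale≢0 b n k}} (ℕ.*-monoʳ-≤ b q≤D)))) ,
  λ pQ∈as → ℕ.<⇒≱ B<Q (proj₂ (∃-bound as) pQ∈as)
  where
  B = proj₁ (∃-bound as)
  -- The denominator of `c` takes care of the i-th coordinate; the factor B + 1 pushes `Q` beyond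
  -- every denominator in `as`.
  b = ℚ.↧ₙ c ℕ.* suc B
  instance
    b≢0 : NonZero b
    b≢0 = ℕ.m*n≢0 (ℚ.↧ₙ c) (suc B)
  k = proj₁ (large b)
  h = ½ ^ℚ k
  approximation = dirichlet-hyperplane i {c} k (suc B) x xᵢ≈c
  q = proj₁ approximation
  q≢0 : NonZero q
  q≢0 = proj₁ (proj₂ approximation)
  q≤D : q ℕ.≤ 2 ℕ.^ (k ℕ.* n)
  q≤D = proj₁ (proj₂ (proj₂ approximation))
  close = proj₂ (proj₂ (proj₂ approximation))
  Q = b ℕ.* q
  Q≢0 : NonZero Q
  Q≢0 = ℕ.m*n≢0 b q {{b≢0}} {{q≢0}}
  B<Q : B ℕ.< Q
  B<Q = ℕ.≤-trans (ℕ.m≤n*m (suc B) (ℚ.↧ₙ c)) (ℕ.m≤m*n b q {{q≢0}})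
  p : Vec ℤ (suc n)
  p = tabulate (λ l → proj₁ (close l))
  error : ℝ^ suc n
  error l = fromℤ (+ Q) * x l - fromℤ (lookup p l)
  error≤ : ∀ l → ∣ error l ∣ ≤ fromℚ (h ℚ.+ h)
  error≤ l = subst (λ z → ∣ fromℤ (+ Q) * x l - fromℤ z ∣ ≤ fromℚ (h ℚ.+ h))
    (sym (Vec.lookup∘tabulate (λ l → proj₁ (close l)) l)) (proj₂ (close l))

-- Convergence of power sums

+-fromℚ-≤ : ∀ {x y p q} → x ≤ fromℚ p → y ≤ fromℚ q → x + y ≤ fromℚ (p ℚ.+ q)
+-fromℚ-≤ {x} {y} {p} {q} x≤p y≤q ε 0<ε = eventually-zip
  (λ n → add (seq x n) (seq y n)) (x≤p (½ ℚ.* ε) (half>0 0<ε)) (y≤q (½ ℚ.* ε) (half>0 0<ε))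
  where
  lemma : ∀ p q e → (p ℚ.+ e) ℚ.+ (q ℚ.+ e) ≡ (p ℚ.+ q) ℚ.+ (e ℚ.+ e)
  lemma = solve 3 (λ p q e → (p :+ e) :+ (q :+ e) := (p :+ q) :+ (e :+ e)) refl
  add : ∀ s t → s ℚ.≤ p ℚ.+ ½ ℚ.* ε → t ℚ.≤ q ℚ.+ ½ ℚ.* ε → s ℚ.+ t ℚ.≤ (p ℚ.+ q) ℚ.+ ε
  add s t s≤ t≤ = subst (s ℚ.+ t ℚ.≤_)
    (trans (lemma p q (½ ℚ.* ε)) (cong ((p ℚ.+ q) ℚ.+_) (halves ε))) (ℚ.+-mono-≤ s≤ t≤)

seq-^ : ∀ x m n → seq (x ^ m) n ≡ seq x n ^ℚ m
seq-^ x zero    n = refl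
seq-^ x (suc m) n = cong (seq x n ℚ.*_) (seq-^ x m n)

-- Doubling B absorbs the error terms of the real inequalities.
^-fromℚ-≤ : ∀ {x B} → 0ℝ ≤ x → x ≤ fromℚ B → 0ℚ ℚ.< B → ∀ m → x ^ m ≤ fromℚ ((B ℚ.+ B) ^ℚ m)
^-fromℚ-≤ {x} {B} 0≤x x≤B 0<B m = eventually⇒≤ {x ^ m} {fromℚ ((B ℚ.+ B) ^ℚ m)}
  (eventually-zip (λ n → bound n) (0≤x B 0<B) (x≤B B 0<B))
  where
  neg : ∀ {t} → 0ℚ ℚ.≤ t ℚ.+ B → 0ℚ ℚ.≤ t ℚ.+ (B ℚ.+ B)
  neg {t} 0≤ = ≤-shift (ℚ.+-mono-≤ 0≤ (ℚ.<⇒≤ 0<B)) (lemma t B)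
    where
    lemma : ∀ t B → 0ℚ ℚ.+ ((t ℚ.+ B) ℚ.+ B) ≡ (t ℚ.+ (B ℚ.+ B)) ℚ.+ (0ℚ ℚ.+ 0ℚ)
    lemma = solve 2 (λ t B → con 0ℚ :+ ((t :+ B) :+ B) := (t :+ (B :+ B)) :+ (con 0ℚ :+ con 0ℚ)) refl
  bound : ∀ n → 0ℚ ℚ.≤ seq x n ℚ.+ B → seq x n ℚ.≤ B ℚ.+ B → seq (x ^ m) n ℚ.≤ (B ℚ.+ B) ^ℚ m
  bound n 0≤ ≤2B = subst (ℚ._≤ (B ℚ.+ B) ^ℚ m) (sym (seq-^ x m n))
    (ℚ.≤-trans (p≤∣p∣ (seq x n ^ℚ m)) (∣^∣-mono-≤ ∣x∣≤ m))
    where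
    ∣x∣≤ : ℚ.∣ seq x n ∣ ℚ.≤ B ℚ.+ B
    ∣x∣≤ = subst (λ t → ℚ.∣ t ∣ ℚ.≤ B ℚ.+ B) (ℚ.+-identityʳ (seq x n))
      (∣p-q∣≤ {seq x n} {0ℚ} (subst (seq x n ℚ.≤_) (sym (ℚ.+-identityˡ (B ℚ.+ B))) ≤2B) (neg {seq x n} 0≤))

powerSum-block : ∀ f d M {P h} → (∀ q .{{_ : NonZero q}} → M ℕ.≤ q → ψ f q ^ d ≤ fromℚ h) →
  powerSum f d M ≤ fromℚ P → ∀ j → powerSum f d (M ℕ.+ j) ≤ fromℚ (P ℚ.+ ι j ℚ.* h)
powerSum-block f d M {P} {h} ψ≤ base zero = subst₂ (λ N p → powerSum f d N ≤ fromℚ p)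
  (sym (ℕ.+-identityʳ M))
  (sym (trans (cong (λ z → P ℚ.+ z ℚ.* h) ι-0)
    (trans (cong (P ℚ.+_) (ℚ.*-zeroˡ h)) (ℚ.+-identityʳ P))))
  base
powerSum-block f d M {P} {h} ψ≤ base (suc j) = subst₂ (λ N p → powerSum f d N ≤ fromℚ p)
  (sym (ℕ.+-suc M j)) (trans (lemma P (ι j) h) (cong (λ z → P ℚ.+ z ℚ.* h) (sym (ι-suc j))))
  (+-fromℚ-≤ {powerSum f d (M ℕ.+ j)} {ψ f (suc (M ℕ.+ j)) ^ d} {P ℚ.+ ι j ℚ.* h} {h}
    (powerSum-block f d M {P} {h} ψ≤ base j)
    (ψ≤ (suc (M ℕ.+ j)) (ℕ.m≤n⇒m≤1+n (ℕ.m≤m+n M j))))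
  where
  lemma : ∀ P j h → (P ℚ.+ j ℚ.* h) ℚ.+ h ≡ P ℚ.+ (1ℚ ℚ.+ j) ℚ.* h
  lemma = solve 3 (λ P j h → (P :+ j :* h) :+ h := P :+ (con 1ℚ :+ j) :* h) refl

∃-fromℚ-bound : ∀ x → ∃[ B ] 0ℚ ℚ.< B × x ≤ fromℚ B
∃-fromℚ-bound x = B , ℚ.positive⁻¹ B {{B>0}} , eventually⇒≤ {x} {fromℚ B}
  (eventually-map (λ n → ℚ.≤-trans (p≤∣p∣ (seq x n))) bounded)
  where
  bounding = eventuallyBounded {seq x} (cauchy x)
  B = proj₁ bounding
  B>0 = proj₁ (proj₂ bounding)
  bounded = proj₂ (proj₂ bounding)

-- On (scale b m k, scale b m (suc k)] the terms of the series are at most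
-- (2A/2ᵏᵉ)ⁿ⁺¹; there are at most b 2ᵐ 2ᵏᵐ of them, and e (n + 1) = m + 1.
scale*power : ∀ b m k e n {A} → suc m ≡ e ℕ.* suc n →
  ι (scale b m (suc k)) ℚ.* (A ℚ.* ½ ^ℚ (k ℕ.* e) ℚ.+ A ℚ.* ½ ^ℚ (k ℕ.* e)) ^ℚ suc n
    ≡ (ι b ℚ.* ι (2 ℕ.^ m) ℚ.* (A ℚ.+ A) ^ℚ suc n) ℚ.* ½ ^ℚ k
scale*power b m k e n {A} eq = begin
  ι (scale b m (suc k)) ℚ.* (A ℚ.* g ℚ.+ A ℚ.* g) ^ℚ suc n
    ≡⟨ cong₂ ℚ._*_ ι-scale power ⟩
  (ι b ℚ.* (ι (2 ℕ.^ m) ℚ.* ι (2 ℕ.^ (k ℕ.* m)))) ℚ.* ((A ℚ.+ A) ^ℚ suc n ℚ.* (½ ^ℚ k ℚ.* ½ ^ℚ (k ℕ.* m)))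
    ≡⟨ lemma (ι b) (ι (2 ℕ.^ m)) (ι (2 ℕ.^ (k ℕ.* m))) ((A ℚ.+ A) ^ℚ suc n) (½ ^ℚ k) (½ ^ℚ (k ℕ.* m)) ⟩
  (ι b ℚ.* ι (2 ℕ.^ m) ℚ.* (A ℚ.+ A) ^ℚ suc n) ℚ.* ½ ^ℚ k ℚ.* (ι (2 ℕ.^ (k ℕ.* m)) ℚ.* ½ ^ℚ (k ℕ.* m))
    ≡⟨ trans (cong (K ℚ.* ½ ^ℚ k ℚ.*_) (ι2^*½^ (k ℕ.* m))) (ℚ.*-identityʳ (K ℚ.* ½ ^ℚ k)) ⟩
  (ι b ℚ.* ι (2 ℕ.^ m) ℚ.* (A ℚ.+ A) ^ℚ suc n) ℚ.* ½ ^ℚ k ∎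
  where
  open ≡-Reasoning
  g = ½ ^ℚ (k ℕ.* e)
  K = ι b ℚ.* ι (2 ℕ.^ m) ℚ.* (A ℚ.+ A) ^ℚ suc n
  lemma : ∀ b m s a h t → (b ℚ.* (m ℚ.* s)) ℚ.* (a ℚ.* (h ℚ.* t)) ≡ (b ℚ.* m ℚ.* a) ℚ.* h ℚ.* (s ℚ.* t)
  lemma = solve 6 (λ b m s a h t → (b :* (m :* s)) :* (a :* (h :* t)) := (b :* m :* a) :* h :* (s :* t)) refl
  ι-scale : ι (scale b m (suc k)) ≡ ι b ℚ.* (ι (2 ℕ.^ m) ℚ.* ι (2 ℕ.^ (k ℕ.* m)))
  ι-scale = trans (ι-* b (2 ℕ.^ (m ℕ.+ k ℕ.* m))) (cong (ι b ℚ.*_)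
    (trans (cong ι (ℕ.^-distribˡ-+-* 2 m (k ℕ.* m))) (ι-* (2 ℕ.^ m) (2 ℕ.^ (k ℕ.* m)))))
  exponents : k ℕ.* e ℕ.* suc n ≡ k ℕ.+ k ℕ.* m
  exponents = trans (ℕ.*-assoc k e (suc n)) (trans (cong (k ℕ.*_) (sym eq)) (ℕ.*-suc k m))
  power : (A ℚ.* g ℚ.+ A ℚ.* g) ^ℚ suc n ≡ (A ℚ.+ A) ^ℚ suc n ℚ.* (½ ^ℚ k ℚ.* ½ ^ℚ (k ℕ.* m))
  power = begin
    (A ℚ.* g ℚ.+ A ℚ.* g) ^ℚ suc n                 ≡⟨ cong (_^ℚ suc n) (ℚ.*-distribʳ-+ g A A) ⟨
    ((A ℚ.+ A) ℚ.* g) ^ℚ suc n                     ≡⟨ ^-distrib-* (A ℚ.+ A) g (suc n) ⟩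
    (A ℚ.+ A) ^ℚ suc n ℚ.* g ^ℚ suc n              ≡⟨ cong ((A ℚ.+ A) ^ℚ suc n ℚ.*_) (trans
                                                     (^-assocʳ ½ (k ℕ.* e) (suc n)) (trans
                                                     (cong (½ ^ℚ_) exponents) (^-homo-* ½ k (k ℕ.* m)))) ⟩
    (A ℚ.+ A) ^ℚ suc n ℚ.* (½ ^ℚ k ℚ.* ½ ^ℚ (k ℕ.* m)) ∎

-- Places every partial sum before the end of some block.
n≤scale : ∀ b .{{_ : NonZero b}} m .{{_ : NonZero m}} N → N ℕ.≤ scale b m N
n≤scale b m N = ℕ.≤-trans (ℕ.<⇒≤ (n<2^n N))
  (ℕ.≤-trans (ℕ.^-monoʳ-≤ 2 (ℕ.m≤m*n N m)) (ℕ.m≤n*m (2 ℕ.^ (N ℕ.* m)) b))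

-- Cauchy condensation along b 2ᵏᵐ: the k-th block contributes at most K/2ᵏ, so the partial sums are
-- dominated by a geometric series.
seriesConverges : ∀ f b .{{_ : NonZero b}} m .{{_ : NonZero m}} e n {A} → suc m ≡ e ℕ.* suc n → 0ℚ ℚ.< A →
  (∀ k → ψ-scale f b m k ≤ fromℚ (A ℚ.* ½ ^ℚ (k ℕ.* e))) → SeriesConverges f (suc n)
seriesConverges f b m e n {A} eq 0<A ψ≤ = fromℚ (P ℚ.+ K ℚ.* (1ℚ ℚ.+ 1ℚ)) , λ N →
  ≤-trans {powerSum f d N} {fromℚ (S N)} {fromℚ (P ℚ.+ K ℚ.* (1ℚ ℚ.+ 1ℚ))}
    (bound N N (n≤scale b m N)) (fromℚ-mono-≤ {S N} (S≤ N))
  where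
  d = suc n
  B = proj₁ (∃-fromℚ-bound (ψ f 1))
  0<B : 0ℚ ℚ.< B
  0<B = proj₁ (proj₂ (∃-fromℚ-bound (ψ f 1)))
  -- Covers the first b terms, each bounded through ψ(q) ≤ ψ(1) ≤ B. The leading zero matches the
  -- form of `powerSum-block`.
  P = 0ℚ ℚ.+ ι (scale b m 0) ℚ.* (B ℚ.+ B) ^ℚ d
  K = ι b ℚ.* ι (2 ℕ.^ m) ℚ.* (A ℚ.+ A) ^ℚ d
  0≤K : 0ℚ ℚ.≤ K
  0≤K = *-nonNeg (*-nonNeg (ι-nonNeg b) (ι-nonNeg (2 ℕ.^ m)))
    (^-nonNeg (+-nonNeg (ℚ.<⇒≤ 0<A) (ℚ.<⇒≤ 0<A)) d)
  -- 2 - 2/2ᵏ is the geometric sum of 1/2ʲ over j < k.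
  S : ℕ → ℚ
  S k = P ℚ.+ K ℚ.* ((1ℚ ℚ.+ 1ℚ) ℚ.- (½ ^ℚ k ℚ.+ ½ ^ℚ k))

  S≤ : ∀ k → S k ℚ.≤ P ℚ.+ K ℚ.* (1ℚ ℚ.+ 1ℚ)
  S≤ k = ℚ.+-monoʳ-≤ P (*-monoˡ-≤ 0≤K (≤-shift (+-nonNeg (½^≥0 k) (½^≥0 k)) (lemma (1ℚ ℚ.+ 1ℚ) (½ ^ℚ k ℚ.+ ½ ^ℚ k))))
    where
    lemma : ∀ a h → (a ℚ.- h) ℚ.+ h ≡ a ℚ.+ 0ℚ
    lemma = solve 2 (λ a h → (a :- h) :+ h := a :+ con 0ℚ) refl

  S-suc : ∀ k → S (suc k) ≡ S k ℚ.+ K ℚ.* ½ ^ℚ k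
  S-suc k = trans (cong (λ z → P ℚ.+ K ℚ.* ((1ℚ ℚ.+ 1ℚ) ℚ.- z)) (½^-halves k)) (lemma P K (½ ^ℚ k))
    where
    lemma : ∀ P K h → P ℚ.+ K ℚ.* ((1ℚ ℚ.+ 1ℚ) ℚ.- h)
          ≡ (P ℚ.+ K ℚ.* ((1ℚ ℚ.+ 1ℚ) ℚ.- (h ℚ.+ h))) ℚ.+ K ℚ.* h
    lemma = solve 3 (λ P K h → P :+ K :* ((con 1ℚ :+ con 1ℚ) :- h)
          := (P :+ K :* ((con 1ℚ :+ con 1ℚ) :- (h :+ h))) :+ K :* h) refl

  termBound : ∀ k → ℚ
  termBound k = (A ℚ.* ½ ^ℚ (k ℕ.* e) ℚ.+ A ℚ.* ½ ^ℚ (k ℕ.* e)) ^ℚ d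
  term≤ : ∀ k q .{{_ : NonZero q}} → scale b m k ℕ.≤ q → ψ f q ^ d ≤ fromℚ (termBound k)
  term≤ k q k≤q = ^-fromℚ-≤ {ψ f q} (nonNegative f q)
    (≤-trans {ψ f q} {ψ-scale f b m k} {fromℚ (A ℚ.* ½ ^ℚ (k ℕ.* e))}
      (nonIncreasing f (scale b m k) q {{scale≢0 b m k}} k≤q) (ψ≤ k))
    (*-pos 0<A (½^>0 (k ℕ.* e))) d
  term≥0 : ∀ k → 0ℚ ℚ.≤ termBound k
  term≥0 k = ^-nonNeg (+-nonNeg 0≤ 0≤) d
    where
    0≤ : 0ℚ ℚ.≤ A ℚ.* ½ ^ℚ (k ℕ.* e)
    0≤ = *-nonNeg (ℚ.<⇒≤ 0<A) (½^≥0 (k ℕ.* e))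

  bound : ∀ k N → N ℕ.≤ scale b m k → powerSum f d N ≤ fromℚ (S k)
  bound zero N N≤ = ≤-trans {powerSum f d N} {fromℚ (0ℚ ℚ.+ ι N ℚ.* (B ℚ.+ B) ^ℚ d)} {fromℚ (S 0)}
    (powerSum-block f d 0 {0ℚ} {(B ℚ.+ B) ^ℚ d} (λ q _ → ^-fromℚ-≤ {ψ f q} (nonNegative f q)
        (≤-trans {ψ f q} {ψ f 1} {fromℚ B} (nonIncreasing f 1 q (ℕ.>-nonZero⁻¹ q)) (proj₂ (proj₂ (∃-fromℚ-bound (ψ f 1)))))
        0<B d)
      (fromℚ-mono-≤ {0ℚ} ℚ.≤-refl) N)
    (fromℚ-mono-≤ {q = S 0} (subst (0ℚ ℚ.+ ι N ℚ.* (B ℚ.+ B) ^ℚ d ℚ.≤_) S0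
      (ℚ.+-monoʳ-≤ 0ℚ (*-monoʳ-≤ (^-nonNeg (+-nonNeg (ℚ.<⇒≤ 0<B) (ℚ.<⇒≤ 0<B)) d) (ι-mono-≤ {N} {scale b m 0} N≤)))))
    where
    S0 : P ≡ S 0
    S0 = sym (trans (cong (P ℚ.+_) (ℚ.*-zeroʳ K)) (ℚ.+-identityʳ P))
  bound (suc k) N N≤ = [ early , late ]′ (ℕ.≤-total N (scale b m k))
    where
    early : N ℕ.≤ scale b m k → powerSum f d N ≤ fromℚ (S (suc k))
    early N≤k = ≤-trans {powerSum f d N} {fromℚ (S k)} {fromℚ (S (suc k))} (bound k N N≤k)
      (fromℚ-mono-≤ {S k} {S (suc k)} (subst₂ ℚ._≤_ (ℚ.+-identityʳ (S k)) (sym (S-suc k))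
        (ℚ.+-monoʳ-≤ (S k) (*-nonNeg 0≤K (½^≥0 k)))))
    -- A crude count: the number of terms after index `scale b m k` is bounded by
    -- `scale b m (suc k)`.
    late : scale b m k ℕ.≤ N → powerSum f d N ≤ fromℚ (S (suc k))
    late k≤N = ≤-trans {powerSum f d N} {fromℚ (S k ℚ.+ ι j ℚ.* termBound k)} {fromℚ (S (suc k))}
      (subst (λ N → powerSum f d N ≤ fromℚ (S k ℚ.+ ι j ℚ.* termBound k)) (ℕ.m+[n∸m]≡n k≤N)
        (powerSum-block f d (scale b m k) {S k} {termBound k} (term≤ k) (bound k (scale b m k) ℕ.≤-refl) j))
      (fromℚ-mono-≤ {S k ℚ.+ ι j ℚ.* termBound k} {S (suc k)} (begin
        S k ℚ.+ ι j ℚ.* termBound k                       ≤⟨ ℚ.+-monoʳ-≤ (S k) (*-monoʳ-≤ (term≥0 k) (ι-mono-≤ {j} {scale b m (suc k)}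
                                                             (ℕ.≤-trans (ℕ.m∸n≤m N (scale b m k)) N≤))) ⟩
        S k ℚ.+ ι (scale b m (suc k)) ℚ.* termBound k     ≡⟨ cong (S k ℚ.+_) (scale*power b m k e n {A} eq) ⟩
        S k ℚ.+ K ℚ.* ½ ^ℚ k                              ≡⟨ S-suc k ⟨
        S (suc k)                                         ∎))
      where
      open ℚ.≤-Reasoning
      j = N ℕ.∸ scale b m k

-- Finite sums

∑ : (ℕ → ℚ) → ℕ → ℚ
∑ g zero    = 0ℚ
∑ g (suc K) = g 0 ℚ.+ ∑ (g ∘ suc) K

∑-foldr : ∀ g K → foldr ℚ._+_ 0ℚ {K} (λ k → g (toℕ k)) ≡ ∑ g K
∑-foldr g zero    = refl
∑-foldr g (suc K) = cong (g 0 ℚ.+_) (∑-foldr (g ∘ suc) K)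

∑-cong : ∀ {g h} → (∀ k → g k ≡ h k) → ∀ K → ∑ g K ≡ ∑ h K
∑-cong g≡h zero    = refl
∑-cong g≡h (suc K) = cong₂ ℚ._+_ (g≡h 0) (∑-cong (g≡h ∘ suc) K)

∑-mono-≤ : ∀ {g h} → (∀ k → g k ℚ.≤ h k) → ∀ K → ∑ g K ℚ.≤ ∑ h K
∑-mono-≤ g≤h zero    = ℚ.≤-refl
∑-mono-≤ g≤h (suc K) = ℚ.+-mono-≤ (g≤h 0) (∑-mono-≤ (g≤h ∘ suc) K)

-- Finitely many thresholds have a maximum.
∑-mono-eventually : ∀ {g h : ℕ → ℕ → ℚ} → (∀ k → Eventually (λ n → g k n ℚ.≤ h k n)) →
  ∀ K → Eventually (λ n → ∑ (λ k → g k n) K ℚ.≤ ∑ (λ k → h k n) K)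
∑-mono-eventually g≤h zero    = 0 , λ _ _ → ℚ.≤-refl
∑-mono-eventually g≤h (suc K) =
  eventually-zip (λ n → ℚ.+-mono-≤) (g≤h 0) (∑-mono-eventually (g≤h ∘ suc) K)

∑-nonNeg : ∀ {g} → (∀ k → 0ℚ ℚ.≤ g k) → ∀ K → 0ℚ ℚ.≤ ∑ g K
∑-nonNeg 0≤g zero    = ℚ.≤-refl
∑-nonNeg 0≤g (suc K) = +-nonNeg (0≤g 0) (∑-nonNeg (0≤g ∘ suc) K)

∑-monoʳ-≤ : ∀ {g} → (∀ k → 0ℚ ℚ.≤ g k) → ∀ {K L} → K ℕ.≤ L → ∑ g K ℚ.≤ ∑ g L
∑-monoʳ-≤     0≤g {L = L} ℕ.z≤n     = ∑-nonNeg 0≤g L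
∑-monoʳ-≤ {g} 0≤g         (ℕ.s≤s K≤L) = ℚ.+-monoʳ-≤ (g 0) (∑-monoʳ-≤ (0≤g ∘ suc) K≤L)

term≤∑ : ∀ {g} → (∀ k → 0ℚ ℚ.≤ g k) → ∀ k → g k ℚ.≤ ∑ g (suc k)
term≤∑ {g} 0≤g zero    = ℚ.≤-reflexive (sym (ℚ.+-identityʳ (g 0)))
term≤∑ {g} 0≤g (suc k) = subst (ℚ._≤ ∑ g (suc (suc k))) (ℚ.+-identityˡ (g (suc k)))
  (ℚ.+-mono-≤ (0≤g 0) (term≤∑ (0≤g ∘ suc) k))

∑-+ : ∀ g h K → ∑ (λ k → g k ℚ.+ h k) K ≡ ∑ g K ℚ.+ ∑ h K
∑-+ g h zero    = refl
∑-+ g h (suc K) = trans (cong ((g 0 ℚ.+ h 0) ℚ.+_) (∑-+ (g ∘ suc) (h ∘ suc) K))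
  (lemma (g 0) (h 0) (∑ (g ∘ suc) K) (∑ (h ∘ suc) K))
  where
  lemma : ∀ a b c d → (a ℚ.+ b) ℚ.+ (c ℚ.+ d) ≡ (a ℚ.+ c) ℚ.+ (b ℚ.+ d)
  lemma = solve 4 (λ a b c d → (a :+ b) :+ (c :+ d) := (a :+ c) :+ (b :+ d)) refl

∑-*ʳ : ∀ g c K → ∑ (λ k → g k ℚ.* c) K ≡ ∑ g K ℚ.* c
∑-*ʳ g c zero    = sym (ℚ.*-zeroˡ c)
∑-*ʳ g c (suc K) = trans (cong (g 0 ℚ.* c ℚ.+_) (∑-*ʳ (g ∘ suc) c K))
  (sym (ℚ.*-distribʳ-+ c (g 0) (∑ (g ∘ suc) K)))

-- This is δ/2ᵏ⁺¹; the recursion runs through `δ` so that the induction in `∑-halving` can pass from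
-- δ to δ/2.
halving : ℚ → ℕ → ℚ
halving δ zero    = ½ ℚ.* δ
halving δ (suc k) = halving (½ ℚ.* δ) k

halving>0 : ∀ {δ} → 0ℚ ℚ.< δ → ∀ k → 0ℚ ℚ.< halving δ k
halving>0 0<δ zero    = half>0 0<δ
halving>0 0<δ (suc k) = halving>0 (half>0 0<δ) k

∑-halving : ∀ {δ} → 0ℚ ℚ.< δ → ∀ K → ∑ (halving δ) K ℚ.≤ δ
∑-halving     0<δ zero    = ℚ.<⇒≤ 0<δ
∑-halving {δ} 0<δ (suc K) = subst (½ ℚ.* δ ℚ.+ ∑ (halving (½ ℚ.* δ)) K ℚ.≤_) (halves δ)
  (ℚ.+-monoʳ-≤ (½ ℚ.* δ) (∑-halving (half>0 0<δ) K))

-- Bisection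

-- For l ≤ u and a ≤ b, the increment of `clamp l u` from a to b is the length of the overlap of
-- [a, b] with [l, u].
clamp : ℚ → ℚ → ℚ → ℚ
clamp l u t = l ℚ.⊔ (t ℚ.⊓ u)

clamp-mono-≤ : ∀ l u {s t} → s ℚ.≤ t → clamp l u s ℚ.≤ clamp l u t
clamp-mono-≤ l u s≤t = ℚ.⊔-monoʳ-≤ l (ℚ.⊓-monoˡ-≤ u s≤t)

clamp-spread : ∀ {l u} → l ℚ.≤ u → ∀ s t → clamp l u t ℚ.- clamp l u s ℚ.≤ u ℚ.- l
clamp-spread {l} {u} l≤u s t = ℚ.+-mono-≤ (ℚ.⊔-lub l≤u (ℚ.p⊓q≤q t u))
  (ℚ.neg-antimono-≤ (ℚ.p≤p⊔q l (s ℚ.⊓ u)))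

clamp-id : ∀ {l u t} → l ℚ.≤ t → t ℚ.≤ u → clamp l u t ≡ t
clamp-id {l} l≤t t≤u = trans (cong (l ℚ.⊔_) (ℚ.p≤q⇒p⊓q≡p t≤u)) (ℚ.p≤q⇒p⊔q≡q l≤t)

-- If all partial sums of the non-decreasing functions Gₖ have mean slope at
-- most ρ on an interval, the same holds on one of its halves: the increments
-- are additive, and non-decreasing in the number of summands.
module Bisection (em : ExcludedMiddle 0ℓ) (G : ℕ → ℚ → ℚ)
  (G-mono : ∀ k {s t} → s ℚ.≤ t → G k s ℚ.≤ G k t) (ρ : ℚ) where

  increment : ℚ → ℚ → ℕ → ℚ
  increment a b = ∑ (λ k → G k b ℚ.- G k a)

  Sparse : ℚ → ℚ → Set
  Sparse a h = ∀ K → increment a (a ℚ.+ h) K ℚ.≤ ρ ℚ.* h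

  increment-mono-≤ : ∀ {a b} → a ℚ.≤ b → ∀ {K L} → K ℕ.≤ L → increment a b K ℚ.≤ increment a b L
  increment-mono-≤ {a} {b} a≤b = ∑-monoʳ-≤ (λ k → subst (ℚ._≤ G k b ℚ.- G k a) (ℚ.+-inverseʳ (G k a))
    (ℚ.+-monoˡ-≤ (ℚ.- G k a) (G-mono k a≤b)))

  increment-+ : ∀ a b c K → increment a c K ≡ increment a b K ℚ.+ increment b c K
  increment-+ a b c K = trans (∑-cong (λ k → lemma (G k a) (G k b) (G k c)) K)
    (∑-+ (λ k → G k b ℚ.- G k a) (λ k → G k c ℚ.- G k b) K)
    where
    lemma : ∀ a b c → c ℚ.- a ≡ (b ℚ.- a) ℚ.+ (c ℚ.- b)
    lemma = solve 3 (λ a b c → c :- a := (b :- a) :+ (c :- b)) refl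

  halve : ∀ a h → 0ℚ ℚ.≤ h → Sparse a (h ℚ.+ h) → Sparse a h ⊎ Sparse (a ℚ.+ h) h
  halve a h 0≤h sparse = [ inj₂ ∘ right , inj₁ ∘ left ]′ (toSum em)
    where
    DenseLeft = ∃[ K ] ρ ℚ.* h ℚ.< increment a (a ℚ.+ h) K
    left : ¬ DenseLeft → Sparse a h
    left ¬dense K = ℚ.≮⇒≥ (λ lt → ¬dense (K , lt))
    0≤⇒≤+ : ∀ b → b ℚ.≤ b ℚ.+ h
    0≤⇒≤+ b = subst (ℚ._≤ b ℚ.+ h) (ℚ.+-identityʳ b) (ℚ.+-monoʳ-≤ b 0≤h)
    -- At stage `L` the left half takes at least ρ h out of a total of at most 2ρ h, so at most ρ h
    -- remains for the right half. Stage `K` inherits this bound because K ≤ L.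
    right : DenseLeft → Sparse (a ℚ.+ h) h
    right (K′ , dense) K = ℚ.≤-trans
      (increment-mono-≤ (0≤⇒≤+ (a ℚ.+ h)) (ℕ.m≤m⊔n K K′))
      (≤-shift (ℚ.+-mono-≤ (sparse L) (ℚ.≤-trans (ℚ.<⇒≤ dense) (increment-mono-≤ (0≤⇒≤+ a) (ℕ.m≤n⊔m K K′))))
        (trans (lemma ρ h (increment a m L) (increment m c L))
          (cong (λ z → ρ ℚ.* h ℚ.+ (z ℚ.+ ρ ℚ.* h)) (sym whole))))
      where
      L = K ℕ.⊔ K′
      m = a ℚ.+ h
      c = m ℚ.+ h
      whole : increment a (a ℚ.+ (h ℚ.+ h)) L ≡ increment a m L ℚ.+ increment m c L
      whole = trans (cong (λ b → increment a b L) (sym (ℚ.+-assoc a h h))) (increment-+ a m c L)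
      lemma : ∀ ρ h x y → y ℚ.+ (ρ ℚ.* (h ℚ.+ h) ℚ.+ x) ≡ ρ ℚ.* h ℚ.+ ((x ℚ.+ y) ℚ.+ ρ ℚ.* h)
      lemma = solve 4 (λ ρ h x y → y :+ (ρ :* (h :+ h) :+ x) := ρ :* h :+ ((x :+ y) :+ ρ :* h)) refl

  Half : ℕ → ℚ → Set
  Half n a = ∃[ a′ ] a ℚ.≤ a′ × a′ ℚ.+ ½ ^ℚ suc n ℚ.≤ a ℚ.+ ½ ^ℚ n × Sparse a′ (½ ^ℚ suc n)

  half : ∀ n a → Sparse a (½ ^ℚ n) → Half n a
  half n a sparse = [ lower-half , upper-half ]′
    (halve a (½ ^ℚ suc n) (½^≥0 (suc n)) (subst (Sparse a) (sym (½^-halves n)) sparse))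
    where
    lower-half : Sparse a (½ ^ℚ suc n) → Half n a
    lower-half s = a , ℚ.≤-refl , ℚ.+-monoʳ-≤ a (½^-suc-≤ n) , s
    upper-half : Sparse (a ℚ.+ ½ ^ℚ suc n) (½ ^ℚ suc n) → Half n a
    upper-half s = a ℚ.+ ½ ^ℚ suc n
      , subst (ℚ._≤ a ℚ.+ ½ ^ℚ suc n) (ℚ.+-identityʳ a) (ℚ.+-monoʳ-≤ a (½^≥0 (suc n)))
      , ℚ.≤-reflexive (trans (ℚ.+-assoc a (½ ^ℚ suc n) (½ ^ℚ suc n)) (cong (a ℚ.+_) (½^-halves n))) , s

  module _ (sparse₀ : Sparse 0ℚ 1ℚ) where

    interval : ∀ n → ∃[ a ] Sparse a (½ ^ℚ n)
    interval zero    = 0ℚ , sparse₀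
    interval (suc n) =
      let a , s = interval n ; a′ , _ , _ , s′ = half n a s in a′ , s′

    left : ℕ → ℚ
    left n = proj₁ (interval n)

    left-mono : ∀ {m n} → m ℕ.≤′ n → left m ℚ.≤ left n
    left-mono ℕ.≤′-refl               = ℚ.≤-refl
    left-mono (ℕ.≤′-step {n = n} m≤n) = ℚ.≤-trans (left-mono m≤n)
      (let a , s = interval n in proj₁ (proj₂ (half n a s)))

    right-anti : ∀ {m n} → m ℕ.≤′ n → left n ℚ.+ ½ ^ℚ n ℚ.≤ left m ℚ.+ ½ ^ℚ m
    right-anti ℕ.≤′-refl               = ℚ.≤-refl
    right-anti (ℕ.≤′-step {n = n} m≤n) = ℚ.≤-trans
      (let a , s = interval n in proj₁ (proj₂ (proj₂ (half n a s)))) (right-anti m≤n)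

    left-cauchy : IsCauchy left
    left-cauchy ε 0<ε = N , λ m n N≤m N≤n → ∣p-q∣≤ {left m} {left n} (close m n N≤m N≤n) (close n m N≤n N≤m)
      where
      N = proj₁ (½^-small 0<ε)
      open ℚ.≤-Reasoning
      close : ∀ m n → N ℕ.≤ m → N ℕ.≤ n → left m ℚ.≤ left n ℚ.+ ε
      close m n N≤m N≤n = begin
        left m              ≡⟨ ℚ.+-identityʳ (left m) ⟨
        left m ℚ.+ 0ℚ       ≤⟨ ℚ.+-monoʳ-≤ (left m) (½^≥0 m) ⟩
        left m ℚ.+ ½ ^ℚ m   ≤⟨ right-anti (ℕ.≤⇒≤′ N≤m) ⟩
        left N ℚ.+ ½ ^ℚ N   ≤⟨ ℚ.+-mono-≤ (left-mono (ℕ.≤⇒≤′ N≤n)) (proj₂ (½^-small 0<ε)) ⟩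
        left n ℚ.+ ε        ∎

    -- The n-th term is itself the left end of the n-th interval, so estimates at index n of the
    -- sequence are estimates on that interval.
    limit : ℝ
    limit = mkℝ left left-cauchy

    limit-sparse : ∀ n → Sparse (seq limit n) (½ ^ℚ n)
    limit-sparse n = proj₂ (interval n)

-- Lebesgue measure is positive

indicator : {P : Set} → Dec P → ℚ
indicator (yes _) = 1ℚ
indicator (no  _) = 0ℚ

indicator-true : ∀ {P} (P? : Dec P) → P → indicator P? ≡ 1ℚ
indicator-true (yes _) p = refl
indicator-true (no ¬p) p = contradiction p ¬p

indicator-nonNeg : ∀ {P} (P? : Dec P) → 0ℚ ℚ.≤ indicator P?
indicator-nonNeg (yes _) = ℚ.nonNegative⁻¹ 1ℚ
indicator-nonNeg (no  _) = ℚ.≤-refl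

-- η = δ/(2(w + 1)); adding 1 keeps the divisor positive when w = 0.
shrink : ∀ {w δ} → 0ℚ ℚ.≤ w → 0ℚ ℚ.< δ → ∃[ η ] 0ℚ ℚ.< η × w ℚ.* (η ℚ.+ η) ℚ.≤ δ
shrink {w} {δ} 0≤w 0<δ = ½ ℚ.* δ/B , half>0 0<δ/B , (begin
  w ℚ.* (½ ℚ.* δ/B ℚ.+ ½ ℚ.* δ/B)   ≡⟨ cong (w ℚ.*_) (halves δ/B) ⟩
  w ℚ.* δ/B                         ≤⟨ *-monoʳ-≤ (ℚ.<⇒≤ 0<δ/B)
                                        (≤-shift {p = w} {q = B} (ℚ.nonNegative⁻¹ 1ℚ) (sym (ℚ.+-identityʳ B))) ⟩
  B ℚ.* (δ ℚ.* B⁻¹)                 ≡⟨ lemma B δ B⁻¹ ⟩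
  δ ℚ.* (B ℚ.* B⁻¹)                 ≡⟨ cong (δ ℚ.*_) (ℚ.*-inverseʳ B) ⟩
  δ ℚ.* 1ℚ                          ≡⟨ ℚ.*-identityʳ δ ⟩
  δ                                 ∎)
  where
  open ℚ.≤-Reasoning
  B = w ℚ.+ 1ℚ
  B>0 : ℚ.Positive B
  B>0 = ℚ.nonNeg+pos⇒pos w {{ℚ.nonNegative 0≤w}} 1ℚ
  instance
    B≢0 : ℚ.NonZero B
    B≢0 = ℚ.pos⇒nonZero B {{B>0}}
  B⁻¹ = ℚ.1/ B
  δ/B = δ ℚ.* B⁻¹
  0<δ/B : 0ℚ ℚ.< δ/B
  0<δ/B = quotient>0 {δ} {B} 0<δ B>0
  lemma : ∀ a b c → a ℚ.* (b ℚ.* c) ≡ b ℚ.* (a ℚ.* c)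
  lemma = solve 3 (λ a b c → a :* (b :* c) := b :* (a :* c)) refl

-- A point lying only in sets of total weight at most ρ; coverage bounds the
-- membership indicator k ↦ [point ∈ Iₖ] from above.
record LightPoint {X : Set} (_∈ₖ_ : X → ℕ → Set) (weight : ℕ → ℚ) (ρ : ℚ) : Set where
  field
    point           : X
    coverage        : ℕ → ℚ
    coverage-nonNeg : ∀ k → 0ℚ ℚ.≤ coverage k
    coverage-∈      : ∀ k → point ∈ₖ k → coverage k ≡ 1ℚ
    light           : ∀ K → ∑ (λ k → coverage k ℚ.* weight k) K ℚ.≤ ρ

open LightPoint

-- The intervals are enlarged, so that those containing the limit of a
-- bisection eventually contain the bisected interval.
slice : ExcludedMiddle 0ℓ → ∀ {w l u : ℕ → ℚ} {ρ ρ′} →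
  (∀ k → 0ℚ ℚ.≤ w k) → (∀ k → l k ℚ.≤ u k) → ρ ℚ.< ρ′ →
  (∀ K → ∑ (λ k → w k ℚ.* (u k ℚ.- l k)) K ℚ.≤ ρ) →
  LightPoint (λ x k → fromℚ (l k) ≤ x × x ≤ fromℚ (u k)) w ρ′
slice em {w} {l} {u} {ρ} {ρ′} 0≤w l≤u ρ<ρ′ total =
  record
  { point           = x
  ; coverage        = χ
  ; coverage-nonNeg = λ k → indicator-nonNeg (inside? k)
  ; coverage-∈      = λ k → indicator-true (inside? k)
  ; light           = bound
  }
  where
  δ = ρ′ ℚ.- ρ
  0<δ : 0ℚ ℚ.< δ
  0<δ = subst (ℚ._< δ) (ℚ.+-inverseʳ ρ) (ℚ.+-monoˡ-< (ℚ.- ρ) ρ<ρ′)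
  -- Widening interval k by `η k` at both ends costs at most δ/2ᵏ⁺¹ in weighted length, hence at
  -- most δ = ρ′ - ρ overall.
  η : ℕ → ℚ
  η k = proj₁ (shrink (0≤w k) (halving>0 0<δ k))
  0<η : ∀ k → 0ℚ ℚ.< η k
  0<η k = proj₁ (proj₂ (shrink (0≤w k) (halving>0 0<δ k)))
  wη≤ : ∀ k → w k ℚ.* (η k ℚ.+ η k) ℚ.≤ halving δ k
  wη≤ k = proj₂ (proj₂ (shrink (0≤w k) (halving>0 0<δ k)))
  l⁻ u⁺ : ℕ → ℚ
  l⁻ k = l k ℚ.- η k
  u⁺ k = u k ℚ.+ η k
  l⁻≤u⁺ : ∀ k → l⁻ k ℚ.≤ u⁺ k
  l⁻≤u⁺ k = ≤-shift (ℚ.+-mono-≤ (l≤u k) (+-nonNeg (ℚ.<⇒≤ (0<η k)) (ℚ.<⇒≤ (0<η k)))) (lemma (l k) (u k) (η k))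
    where
    lemma : ∀ l u e → (l ℚ.- e) ℚ.+ (u ℚ.+ (e ℚ.+ e)) ≡ (u ℚ.+ e) ℚ.+ (l ℚ.+ 0ℚ)
    lemma = solve 3 (λ l u e → (l :- e) :+ (u :+ (e :+ e)) := (u :+ e) :+ (l :+ con 0ℚ)) refl
  -- Increments of `G k` are `w k` times the length of the overlap with the widened interval k.
  G : ℕ → ℚ → ℚ
  G k t = w k ℚ.* clamp (l⁻ k) (u⁺ k) t
  G-mono : ∀ k {s t} → s ℚ.≤ t → G k s ℚ.≤ G k t
  G-mono k s≤t = *-monoˡ-≤ (0≤w k) (clamp-mono-≤ (l⁻ k) (u⁺ k) s≤t)
  open Bisection em G G-mono ρ′

  G-increment : ∀ k s t → G k t ℚ.- G k s ≡ w k ℚ.* (clamp (l⁻ k) (u⁺ k) t ℚ.- clamp (l⁻ k) (u⁺ k) s)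
  G-increment k s t = lemma (w k) (clamp (l⁻ k) (u⁺ k) t) (clamp (l⁻ k) (u⁺ k) s)
    where
    lemma : ∀ w a b → w ℚ.* a ℚ.- w ℚ.* b ≡ w ℚ.* (a ℚ.- b)
    lemma = solve 3 (λ w a b → w :* a :- w :* b := w :* (a :- b)) refl

  sparse₀ : Sparse 0ℚ 1ℚ
  sparse₀ K = begin
    ∑ (λ k → G k (0ℚ ℚ.+ 1ℚ) ℚ.- G k 0ℚ) K                 ≤⟨ ∑-mono-≤ term K ⟩
    ∑ (λ k → w k ℚ.* (u k ℚ.- l k) ℚ.+ halving δ k) K      ≡⟨ ∑-+ (λ k → w k ℚ.* (u k ℚ.- l k)) (halving δ) K ⟩
    ∑ (λ k → w k ℚ.* (u k ℚ.- l k)) K ℚ.+ ∑ (halving δ) K  ≤⟨ ℚ.+-mono-≤ (total K) (∑-halving 0<δ K) ⟩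
    ρ ℚ.+ (ρ′ ℚ.- ρ)                                       ≡⟨ cancel ρ ρ′ ⟩
    ρ′ ℚ.* 1ℚ                                              ∎
    where
    open ℚ.≤-Reasoning
    cancel : ∀ a b → a ℚ.+ (b ℚ.- a) ≡ b ℚ.* 1ℚ
    cancel = solve 2 (λ a b → a :+ (b :- a) := b :* con 1ℚ) refl
    expand : ∀ w u l e → w ℚ.* ((u ℚ.+ e) ℚ.- (l ℚ.- e)) ≡ w ℚ.* (u ℚ.- l) ℚ.+ w ℚ.* (e ℚ.+ e)
    expand = solve 4 (λ w u l e → w :* ((u :+ e) :- (l :- e)) := w :* (u :- l) :+ w :* (e :+ e)) refl
    term : ∀ k → G k (0ℚ ℚ.+ 1ℚ) ℚ.- G k 0ℚ ℚ.≤ w k ℚ.* (u k ℚ.- l k) ℚ.+ halving δ k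
    term k = begin
      G k (0ℚ ℚ.+ 1ℚ) ℚ.- G k 0ℚ                               ≡⟨ G-increment k 0ℚ (0ℚ ℚ.+ 1ℚ) ⟩
      w k ℚ.* (clamp (l⁻ k) (u⁺ k) (0ℚ ℚ.+ 1ℚ) ℚ.- clamp (l⁻ k) (u⁺ k) 0ℚ)
                                                               ≤⟨ *-monoˡ-≤ (0≤w k) (clamp-spread (l⁻≤u⁺ k) 0ℚ (0ℚ ℚ.+ 1ℚ)) ⟩
      w k ℚ.* (u⁺ k ℚ.- l⁻ k)                                  ≡⟨ expand (w k) (u k) (l k) (η k) ⟩
      w k ℚ.* (u k ℚ.- l k) ℚ.+ w k ℚ.* (η k ℚ.+ η k)          ≤⟨ ℚ.+-monoʳ-≤ (w k ℚ.* (u k ℚ.- l k)) (wη≤ k) ⟩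
      w k ℚ.* (u k ℚ.- l k) ℚ.+ halving δ k                    ∎

  x = limit sparse₀

  inside? : ∀ k → Dec (fromℚ (l k) ≤ x × x ≤ fromℚ (u k))
  inside? k = em
  χ : ℕ → ℚ
  χ k = indicator (inside? k)

  right : ℕ → ℚ
  right n = seq x n ℚ.+ ½ ^ℚ n

  left≤right : ∀ n → seq x n ℚ.≤ right n
  left≤right n = subst (ℚ._≤ right n) (ℚ.+-identityʳ (seq x n)) (ℚ.+-monoʳ-≤ (seq x n) (½^≥0 n))

  inside : ∀ k → fromℚ (l k) ≤ x × x ≤ fromℚ (u k) →
    Eventually (λ n → l⁻ k ℚ.≤ seq x n × right n ℚ.≤ u⁺ k)
  inside k (l≤x , x≤u) = eventually-zip (λ n → _,_)
    (eventually-map (λ n l≤ → ≤-shift l≤ (lemma (l k) (η k) (seq x n))) (l≤x (η k) (0<η k)))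
    -- At the upper end one half of `η k` absorbs the error of the sequence, the other half the
    -- length of the bisected interval.
    (eventually-zip (λ n x≤ h≤ → subst (right n ℚ.≤_)
        (trans (ℚ.+-assoc (u k) (½ ℚ.* η k) (½ ℚ.* η k)) (cong (u k ℚ.+_) (halves (η k))))
        (ℚ.+-mono-≤ x≤ h≤))
      (x≤u (½ ℚ.* η k) (half>0 (0<η k)))
      (let N , small = ½^-small (half>0 (0<η k)) in N , λ n N≤n → ℚ.≤-trans (½^-anti-≤ N≤n) small))
    where
    lemma : ∀ l e s → (l ℚ.- e) ℚ.+ (s ℚ.+ e) ≡ s ℚ.+ l
    lemma = solve 3 (λ l e s → (l :- e) :+ (s :+ e) := s :+ l) refl

  -- If interval k contains the limit, the bisected interval eventually lies inside the widened one
  -- and the overlap is its full length; otherwise the left side is 0 and `G k` is monotone.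
  collect : ∀ k (I? : Dec (fromℚ (l k) ≤ x × x ≤ fromℚ (u k))) →
    Eventually (λ n → indicator I? ℚ.* w k ℚ.* ½ ^ℚ n ℚ.≤ G k (right n) ℚ.- G k (seq x n))
  collect k (yes I) = eventually-map (λ n → full n) (inside k I)
    where
    lemma : ∀ w s h → 1ℚ ℚ.* w ℚ.* h ≡ w ℚ.* (s ℚ.+ h) ℚ.- w ℚ.* s
    lemma = solve 3 (λ w s h → con 1ℚ :* w :* h := w :* (s :+ h) :- w :* s) refl
    full : ∀ n → l⁻ k ℚ.≤ seq x n × right n ℚ.≤ u⁺ k →
      1ℚ ℚ.* w k ℚ.* ½ ^ℚ n ℚ.≤ G k (right n) ℚ.- G k (seq x n)
    full n (l≤ , ≤u) = ℚ.≤-reflexive (trans (lemma (w k) (seq x n) (½ ^ℚ n))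
      (cong₂ (λ b a → w k ℚ.* b ℚ.- w k ℚ.* a)
        (sym (clamp-id (ℚ.≤-trans l≤ (left≤right n)) ≤u))
        (sym (clamp-id l≤ (ℚ.≤-trans (left≤right n) ≤u)))))
  collect k (no _) = 0 , λ n _ → subst₂ ℚ._≤_
    (trans (ℚ.+-inverseʳ (G k (seq x n))) (lemma (w k) (½ ^ℚ n))) refl
    (ℚ.+-monoˡ-≤ (ℚ.- G k (seq x n)) (G-mono k (left≤right n)))
    where
    lemma : ∀ w h → 0ℚ ≡ 0ℚ ℚ.* w ℚ.* h
    lemma = solve 2 (λ w h → con 0ℚ := con 0ℚ :* w :* h) refl

  -- At a stage `N` late enough for the first `K` intervals, sparseness is divided by the length
  -- 2⁻ᴺ.
  bound : ∀ K → ∑ (λ k → χ k ℚ.* w k) K ℚ.≤ ρ′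
  bound K = ℚ.*-cancelʳ-≤-pos (½ ^ℚ N) {{ℚ.positive (½^>0 N)}} (begin
    ∑ (λ k → χ k ℚ.* w k) K ℚ.* ½ ^ℚ N           ≡⟨ ∑-*ʳ (λ k → χ k ℚ.* w k) (½ ^ℚ N) K ⟨
    ∑ (λ k → χ k ℚ.* w k ℚ.* ½ ^ℚ N) K           ≤⟨ proj₂ eventually N ℕ.≤-refl ⟩
    ∑ (λ k → G k (right N) ℚ.- G k (seq x N)) K  ≤⟨ limit-sparse sparse₀ N K ⟩
    ρ′ ℚ.* ½ ^ℚ N                                ∎)
    where
    open ℚ.≤-Reasoning
    eventually : Eventually (λ n → ∑ (λ k → χ k ℚ.* w k ℚ.* ½ ^ℚ n) K
                               ℚ.≤ ∑ (λ k → G k (right n) ℚ.- G k (seq x n)) K)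
    eventually = ∑-mono-eventually (λ k → collect k (inside? k)) K
    N = proj₁ eventually

tailBox : ∀ {n} → Box (suc n) → Box n
tailBox B = record
  { lower       = lower B ∘ suc
  ; upper       = upper B ∘ suc
  ; lower≤upper = lower≤upper B ∘ suc
  }

volume-nonNeg : ∀ {n} (B : Box n) → 0ℚ ℚ.≤ volume B
volume-nonNeg {zero}  B = ℚ.nonNegative⁻¹ 1ℚ
volume-nonNeg {suc n} B = *-nonNeg
  (subst (ℚ._≤ upper B zero ℚ.- lower B zero) (ℚ.+-inverseʳ (lower B zero))
    (ℚ.+-monoˡ-≤ (ℚ.- lower B zero) (lower≤upper B zero)))
  (volume-nonNeg (tailBox B))

-- Induction on the dimension. The first coordinate is chosen with weights `v k` times the volume of
-- the remaining box; its coverage then multiplies `v k` when the others are chosen. The slack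
-- between ρ and ρ′ is split at `σ`.
slices : ExcludedMiddle 0ℓ → ∀ {n} (B : ℕ → Box n) {v : ℕ → ℚ} {ρ ρ′} →
  (∀ k → 0ℚ ℚ.≤ v k) → ρ ℚ.< ρ′ →
  (∀ K → ∑ (λ k → v k ℚ.* volume (B k)) K ℚ.≤ ρ) →
  LightPoint {ℝ^ n} (λ x k → x ∈Box B k) v ρ′
slices em {zero} B {v} 0≤v ρ<ρ′ total = record
  { point           = λ ()
  -- In dimension 0 every box contains the only point and has volume 1.
  ; coverage        = λ _ → 1ℚ
  ; coverage-nonNeg = λ _ → ℚ.nonNegative⁻¹ 1ℚ
  ; coverage-∈      = λ _ _ → refl
  ; light           = λ K → ℚ.≤-trans (ℚ.≤-reflexive (∑-cong (λ k → ℚ.*-comm 1ℚ (v k)) K))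
                        (ℚ.≤-trans (total K) (ℚ.<⇒≤ ρ<ρ′))
  }
slices em {suc n} B {v} {ρ} {ρ′} 0≤v ρ<ρ′ total = record
  { point           = point first Vector.∷ point rest
  ; coverage        = λ k → coverage rest k ℚ.* coverage first k
  ; coverage-nonNeg = λ k → *-nonNeg (coverage-nonNeg rest k) (coverage-nonNeg first k)
  ; coverage-∈      = λ k x∈B → cong₂ ℚ._*_ (coverage-∈ rest k (x∈B ∘ suc)) (coverage-∈ first k (x∈B zero))
  ; light           = λ K → subst (ℚ._≤ ρ′)
      (∑-cong (λ k → sym (ℚ.*-assoc (coverage rest k) (coverage first k) (v k))) K) (light rest K)
  }
  where
  σ = proj₁ (ℚ.<-dense ρ<ρ′)
  V : ℕ → ℚ
  V k = volume (tailBox (B k))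
  rotate : ∀ v s t → v ℚ.* (s ℚ.* t) ≡ v ℚ.* t ℚ.* s
  rotate = solve 3 (λ v s t → v :* (s :* t) := v :* t :* s) refl
  first : LightPoint (λ x k → fromℚ (lower (B k) zero) ≤ x × x ≤ fromℚ (upper (B k) zero)) (λ k → v k ℚ.* V k) σ
  first = slice em (λ k → *-nonNeg (0≤v k) (volume-nonNeg (tailBox (B k)))) (λ k → lower≤upper (B k) zero)
    (proj₁ (proj₂ (ℚ.<-dense ρ<ρ′)))
    (λ K → subst (ℚ._≤ ρ) (∑-cong (λ k → rotate (v k) (upper (B k) zero ℚ.- lower (B k) zero) (V k)) K) (total K))
  rest : LightPoint {ℝ^ n} (λ x k → x ∈Box tailBox (B k)) (λ k → coverage first k ℚ.* v k) ρ′
  rest = slices em (λ k → tailBox (B k)) (λ k → *-nonNeg (coverage-nonNeg first k) (0≤v k))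
    (proj₂ (proj₂ (ℚ.<-dense ρ<ρ′)))
    (λ K → subst (ℚ._≤ σ) (∑-cong (λ k → sym (ℚ.*-assoc (coverage first k) (v k) (V k))) K) (light first K))

-- A cover of total volume at most ½ admits a light point for some ρ < 1, yet a box containing that
-- point already contributes 1 to the sum.
¬LebesgueNull-universal : ExcludedMiddle 0ℓ → ∀ {n} {S : Pred (ℝ^ n) 0ℓ} → (∀ x → S x) → ¬ LebesgueNull S
¬LebesgueNull-universal em {n} all null = ℚ.<-irrefl refl (begin-strict
  1ℚ                                             ≡⟨ cong (ℚ._* 1ℚ) (coverage-∈ x k x∈B) ⟨
  coverage x k ℚ.* 1ℚ                            ≤⟨ term≤∑ {λ k → coverage x k ℚ.* 1ℚ}
                                                    (λ k → *-nonNeg (coverage-nonNeg x k) (ℚ.nonNegative⁻¹ 1ℚ)) k ⟩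
  ∑ (λ k → coverage x k ℚ.* 1ℚ) (suc k)          ≤⟨ light x (suc k) ⟩
  ρ                                              <⟨ proj₂ (proj₂ (ℚ.<-dense ½<1)) ⟩
  1ℚ                                             ∎)
  where
  open ℚ.≤-Reasoning
  ½<1 : ½ ℚ.< 1ℚ
  ½<1 = from-yes (½ ℚ.<? 1ℚ)
  ρ = proj₁ (ℚ.<-dense ½<1)
  cover = null ½ (ℚ.positive⁻¹ ½)
  B : ℕ → Box n
  B = proj₁ cover
  x : LightPoint {ℝ^ n} (λ x k → x ∈Box B k) (λ _ → 1ℚ) ρ
  x = slices em B (λ _ → ℚ.nonNegative⁻¹ 1ℚ) (proj₁ (proj₂ (ℚ.<-dense ½<1)))
    (λ K → subst (ℚ._≤ ½) (trans (∑-foldr (λ k → volume (B k)) K)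
      (∑-cong (λ k → sym (ℚ.*-identityˡ (volume (B k)))) K)) (proj₂ (proj₂ cover) K))
  k : ℕ
  k = proj₁ (proj₁ (proj₂ cover) (point x) (all (point x)))
  x∈B : point x ∈Box B k
  x∈B = proj₂ (proj₁ (proj₂ cover) (point x) (all (point x)))

-- Degenerate boxes have volume 0 in positive dimension; in dimension 0 every box has volume 1.
LebesgueNull-∅ : ∀ {n} {S : Pred (ℝ^ suc n) 0ℓ} → (∀ x → ¬ S x) → LebesgueNull S
LebesgueNull-∅ {n} empty ε 0<ε = (λ _ → origin) , (λ x Sx → contradiction Sx (empty x)) ,
  λ K → subst (ℚ._≤ ε) (sym (trans (∑-foldr (λ _ → volume origin) K) (zero-sum K))) (ℚ.<⇒≤ 0<ε)
  where
  origin : Box (suc n)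
  origin = record { lower = λ _ → 0ℚ ; upper = λ _ → 0ℚ ; lower≤upper = λ _ → ℚ.≤-refl }
  zero-sum : ∀ K → ∑ (λ _ → volume origin) K ≡ 0ℚ
  zero-sum zero    = refl
  zero-sum (suc K) = cong₂ ℚ._+_ (ℚ.*-zeroˡ (volume (tailBox origin))) (zero-sum K)

-- Critical exponents and the two conclusions

-- The exponents 1/n and 1/(n+1) are the critical ones for Dirichlet's theorem
-- and for convergence; up to a bounded factor, decay n is q^(-1/(n+1/2)).
decay : ℕ → ApproximatingFunction
decay n = record
  { ψ             = λ q → fromℚ (½ ^ℚ (exponent q ℕ.+ exponent q))
  ; nonNegative   = λ q → fromℚ-mono-≤ {0ℚ} (½^≥0 (exponent q ℕ.+ exponent q))
  ; nonIncreasing = λ p q p≤q → fromℚ-mono-≤ {½ ^ℚ (exponent q ℕ.+ exponent q)}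
      (½^-anti-≤ (ℕ.+-mono-≤ (exponent-mono-≤ p≤q) (exponent-mono-≤ p≤q)))
  }
  where
  exponent : ℕ → ℕ
  exponent q = ⌊log₂ q ⌋ ℕ./ suc (n ℕ.+ n)
  exponent-mono-≤ : ∀ {p q} → p ℕ.≤ q → exponent p ℕ.≤ exponent q
  exponent-mono-≤ p≤q = ℕ./-monoˡ-≤ (suc (n ℕ.+ n)) (⌊log₂⌋-mono-≤ p≤q)

-- At q = 2^(k(2n+1)) the exponent is exactly k and the value is ½^(2k), so condensation applies
-- with e = 2, as m + 1 = 2(n + 1).
decay-converges : ∀ n → SeriesConverges (decay n) (suc n)
decay-converges n = seriesConverges (decay n) 1 m 2 n {1ℚ}
  (cong suc (sym (trans (cong (n ℕ.+_) (ℕ.+-identityʳ (suc n))) (ℕ.+-suc n n)))) (ℚ.positive⁻¹ 1ℚ) bound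
  where
  m = suc (n ℕ.+ n)
  exponent : ∀ k → ⌊log₂ scale 1 m k ⌋ ℕ./ m ≡ k
  exponent k = trans (cong (ℕ._/ m) (trans (cong ⌊log₂_⌋ (ℕ.*-identityˡ (2 ℕ.^ (k ℕ.* m)))) (⌊log₂[2^n]⌋≡n (k ℕ.* m))))
    (ℕ.m*n/n≡m k m)
  double : ∀ k → k ℕ.+ k ≡ k ℕ.* 2
  double k = trans (cong (k ℕ.+_) (sym (ℕ.+-identityʳ k))) (ℕ.*-comm 2 k)
  bound : ∀ k → ψ-scale (decay n) 1 m k ≤ fromℚ (1ℚ ℚ.* ½ ^ℚ (k ℕ.* 2))
  bound k = fromℚ-mono-≤ {½ ^ℚ (⌊log₂ scale 1 m k ⌋ ℕ./ m ℕ.+ ⌊log₂ scale 1 m k ⌋ ℕ./ m)}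
    (ℚ.≤-reflexive (trans (cong (½ ^ℚ_) (trans (cong₂ ℕ._+_ (exponent k) (exponent k)) (double k)))
      (sym (ℚ.*-identityˡ (½ ^ℚ (k ℕ.* 2))))))

decay-large : ∀ n b .{{_ : NonZero b}} → ∃[ k ] fromℚ (½ ^ℚ k ℚ.+ ½ ^ℚ k) < ψ-scale (decay n) b n k
decay-large n b = k , ½ ^ℚ suc (b ℕ.+ b) , ½^>0 (suc (b ℕ.+ b)) , 0 , λ _ _ → (begin
  (½ ^ℚ k ℚ.+ ½ ^ℚ k) ℚ.+ ½ ^ℚ suc (b ℕ.+ b)    ≡⟨ cong (ℚ._+ ½ ^ℚ suc (b ℕ.+ b)) (½^-halves (suc (b ℕ.+ b))) ⟩
  ½ ^ℚ suc (b ℕ.+ b) ℚ.+ ½ ^ℚ suc (b ℕ.+ b)     ≡⟨ ½^-halves (b ℕ.+ b) ⟩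
  ½ ^ℚ (b ℕ.+ b)                                ≤⟨ ½^-anti-≤ (ℕ.+-mono-≤ exponent≤b exponent≤b) ⟩
  ½ ^ℚ (exponent ℕ.+ exponent)                  ∎)
  where
  open ℚ.≤-Reasoning
  -- For k = 2b + 2, the logarithm of b 2ᵏⁿ is at most b + k n < (b + 1)(2n + 1), so the exponent is
  -- at most b. Hence ψ is at least ½^(2b), which is twice 2/2ᵏ = ½^(2b+1).
  k = suc (suc (b ℕ.+ b))
  exponent = ⌊log₂ scale b n k ⌋ ℕ./ suc (n ℕ.+ n)
  log≤ : ⌊log₂ scale b n k ⌋ ℕ.≤ b ℕ.+ k ℕ.* n
  log≤ = subst (⌊log₂ scale b n k ⌋ ℕ.≤_)
    (trans (cong ⌊log₂_⌋ (sym (ℕ.^-distribˡ-+-* 2 b (k ℕ.* n)))) (⌊log₂[2^n]⌋≡n (b ℕ.+ k ℕ.* n)))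
    (⌊log₂⌋-mono-≤ (ℕ.*-monoˡ-≤ (2 ℕ.^ (k ℕ.* n)) (ℕ.<⇒≤ (n<2^n b))))
  product : suc b ℕ.+ k ℕ.* n ≡ suc b ℕ.* suc (n ℕ.+ n)
  product = ℕ-Solver.solve 2 (λ b n →
    (ℕ-Solver.con 1 ℕ-Solver.:+ b) ℕ-Solver.:+ (ℕ-Solver.con 2 ℕ-Solver.:+ (b ℕ-Solver.:+ b)) ℕ-Solver.:* n
      ℕ-Solver.:= (ℕ-Solver.con 1 ℕ-Solver.:+ b) ℕ-Solver.:* (ℕ-Solver.con 1 ℕ-Solver.:+ (n ℕ-Solver.:+ n))) refl b n
  exponent≤b : exponent ℕ.≤ b
  exponent≤b = ℕ.s≤s⁻¹ (ℕ.m<n*o⇒m/o<n (subst (⌊log₂ scale b n k ⌋ ℕ.<_) product (ℕ.s≤s log≤)))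

-- If no k worked for this `b`, then ψ(b 2ᵏⁿ) ≤ 2/2ᵏ for all k, and condensation with m = n, e = 1
-- and A = 2 would bound the partial sums.
diverges⇒large : ExcludedMiddle 0ℓ → ∀ {n} .{{_ : NonZero n}} f → SeriesDiverges f (suc n) →
  ∀ b .{{_ : NonZero b}} → ∃[ k ] fromℚ (½ ^ℚ k ℚ.+ ½ ^ℚ k) < ψ-scale f b n k
diverges⇒large em {n} f diverges b = decidable-stable em λ ¬large →
  let M , bounded = seriesConverges f b n 1 n {1ℚ ℚ.+ 1ℚ} (sym (ℕ.+-identityʳ (suc n))) (ℚ.positive⁻¹ (1ℚ ℚ.+ 1ℚ))
        (λ k → ≤-trans {ψ-scale f b n k} {fromℚ (½ ^ℚ k ℚ.+ ½ ^ℚ k)} {fromℚ ((1ℚ ℚ.+ 1ℚ) ℚ.* ½ ^ℚ (k ℕ.* 1))}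
          (≮⇒≥ {ψ-scale f b n k} {½ ^ℚ k ℚ.+ ½ ^ℚ k} (λ lt → ¬large (k , lt)))
          (fromℚ-mono-≤ {½ ^ℚ k ℚ.+ ½ ^ℚ k} (ℚ.≤-reflexive (double k))))
      N , M<sum = diverges M
  in <-irrefl {M} (<-≤-trans {M} {powerSum f (suc n) N} {M} M<sum (bounded N))
  where
  lemma : ∀ h → h ℚ.+ h ≡ (1ℚ ℚ.+ 1ℚ) ℚ.* h
  lemma = solve 1 (λ h → h :+ h := (con 1ℚ :+ con 1ℚ) :* h) refl
  double : ∀ k → ½ ^ℚ k ℚ.+ ½ ^ℚ k ≡ (1ℚ ℚ.+ 1ℚ) ℚ.* ½ ^ℚ (k ℕ.* 1)
  double k = trans (lemma (½ ^ℚ k)) (cong (λ j → (1ℚ ℚ.+ 1ℚ) ℚ.* ½ ^ℚ j) (sym (ℕ.*-identityʳ k)))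

mainTheorem6 : ExcludedMiddle 0ℓ →
    (d : ℕ) → 2 ℕ.≤ d → (i : Fin d) → (c : ℚ) →
    KhintchineDivergence (hyperplane i c) × ¬ KhintchineConvergence (hyperplane i c)
mainTheorem6 em (suc (suc n)) (ℕ.s≤s (ℕ.s≤s ℕ.z≤n)) i c = divergence , ¬convergence
  where
  divergence : KhintchineDivergence (hyperplane i c)
  -- Here d = n + 2, so the hyperplane has positive dimension n + 1, as `LebesgueNull-∅` requires.
  divergence f diverges = LebesgueNull-∅ λ y (y∈H , ¬approximable) →
    ¬approximable (approximable i {c} f (diverges⇒large em f diverges) (insertAt y i (fromℚ c)) y∈H)
  ¬convergence : ¬ KhintchineConvergence (hyperplane i c)
  ¬convergence convergence = ¬LebesgueNull-universal em everywhere
    (convergence (decay (suc n)) (decay-converges (suc n)))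
    where
    on-hyperplane : ∀ y → insertAt y i (fromℚ c) i ≈ fromℚ c
    on-hyperplane y = subst (_≈ fromℚ c) (sym (Vector.insertAt-lookup y i (fromℚ c)))
      (fromℚ-mono-≤ {c} ℚ.≤-refl , fromℚ-mono-≤ {c} ℚ.≤-refl)
    everywhere : ∀ y → insertAt y i (fromℚ c) i ≈ fromℚ c × Approximable (decay (suc n)) (insertAt y i (fromℚ c))
    everywhere y = on-hyperplane y ,
      approximable i {c} (decay (suc n)) (λ b → decay-large (suc n) b) (insertAt y i (fromℚ c)) (on-hyperplane y)
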